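{- Let $(G,\sigma)$ be a connection graph and $i,j\in V$ distinct fixed vertices. Let $\mathcal{V}_{i\to j}:V\to\mathbb{R}^{d\times d}$ be the connection voltage function, i.e. the unique solution of $(\mathcal{L}\mathcal{V}_{i\to j})(x)=0_{d\times d}$ for $x\in V\setminus\{i,j\}$, $\mathcal{V}_{i\to j}(i)=I_{d\times d}$, $\mathcal{V}_{i\to j}(j)=0_{d\times d}$. Then for every $x\in V$, $$\mathcal{V}_{i\to j}(x)=\mathbb{P}^x[T^0_i<T^0_j]\cdot\Omega^0_{xi}(j).$$
   Context: A connection graph $(G,\sigma)$: finite connected weighted graph $G=(V,E,W)$ with $w_{ij}>0$ iff $\{i,j\}\in E$, $\deg(i)=\sum_j w_{ij}$, and $\sigma$ mapping oriented edges to $\mathsf{O}(d)$ with $\sigma_{ji}=\sigma_{ij}^{\mathrm T}$; $(\mathcal{L}f)(x)=\sum_{y\sim x}w_{xy}(f(x)-\sigma_{xy}f(y))$ for $f:V\to\mathbb{R}^{d\times d}$. $(X_t)$ is the simple random walk with transition probabilities $w_{xy}/\deg(x)$; $\mathbb{P}^x,\mathbb{E}^x$ denote probability/expectation given $X_0=x$; $T^0_k=\inf\{t\ge0:X_t=k\}$. The conditional mean path signature is $\Omega^0_{xi}(j)=\mathbb{E}^x\big[\prod_{\ell=1}^{T^0_i}\sigma_{X_{\ell-1}X_\ell}\mid T^0_i<T^0_j\big]$ (ordered product, empty product $=I_d$). -}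

module Defs where

open import Level using (Level; _⊔_) renaming (suc to lsuc)
open import Algebra.Bundles using (CommutativeRing)
open import Algebra.Apartness.Bundles using (HeytingCommutativeRing; HeytingField)
import Algebra.Definitions.RawMonoid as RawMonoidDefinitions
open import Data.Bool.Base using (if_then_else_)
open import Data.Fin.Base using (Fin; zero; suc; toℕ)
open import Data.Fin.Properties using (_≟_)
open import Data.Nat.Base as ℕ using (ℕ; zero; suc)
open import Data.Product.Base using (Σ; ∃; ∃-syntax; _×_; _,_; proj₁; proj₂)
open import Data.Sum.Base using (_⊎_; inj₁; inj₂)
open import Data.Vec.Base using (Vec; []; _∷_; tabulate)
open import Function.Bundles using (_⇔_; module Equivalence)
open import Relation.Binary.Core using (Rel)
open import Relation.Binary.Definitions using (Decidable; Symmetric)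
open import Relation.Binary.Structures using (IsStrictPartialOrder)
open import Relation.Binary.Construct.Closure.ReflexiveTransitive using (Star; _◅_) renaming (ε to nil)
open import Relation.Binary.PropositionalEquality as ≡ using (_≡_; _≢_)
open import Relation.Nullary.Decidable using (does; yes; no)
open import Relation.Nullary.Negation using (¬_; contradiction)
import Algebra.Properties.Semiring.Sum as SemiringSum

-- The real numbers, axiomatised as a Cauchy-complete Archimedean ordered
-- field. The classical reals and the constructive Cauchy reals are both models;
-- classically there is exactly one model up to isomorphism.  No decidability
-- of the order is assumed.
record RealNumbers (c ℓ₁ ℓ₂ : Level) : Set (lsuc (c ⊔ ℓ₁ ⊔ ℓ₂)) where
  infix 4 _<_ _≤_
  field
    heytingField : HeytingField c ℓ₁ ℓ₂

  open HeytingField heytingField public hiding (zero)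
  open HeytingCommutativeRing heytingCommutativeRing public using (commutativeRing)
  open CommutativeRing commutativeRing public using (semiring; +-rawMonoid)
  open RawMonoidDefinitions +-rawMonoid public using () renaming (_×_ to _×ℕ_)

  field
    _<_                  : Rel Carrier ℓ₂
    isStrictPartialOrder : IsStrictPartialOrder _≈_ _<_
    #⇒<⊎>                : ∀ {x y} → x # y → x < y ⊎ y < x
    <⇒#                  : ∀ {x y} → x < y → x # y
    +-monoˡ-<            : ∀ z {x y} → x < y → x + z < y + z
    *-pos                : ∀ {x y} → 0# < x → 0# < y → 0# < x * y

  _≤_ : Rel Carrier ℓ₂
  x ≤ y = ¬ (y < x)

  Cauchy : (ℕ → Carrier) → Set (c ⊔ ℓ₂)
  Cauchy s = ∀ ε → 0# < ε →
    ∃[ N ] ∀ k l → N ℕ.≤ k → N ℕ.≤ l → s k - s l < ε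

  _⟶_ : (ℕ → Carrier) → Carrier → Set (c ⊔ ℓ₂)
  s ⟶ L = ∀ ε → 0# < ε →
    ∃[ N ] ∀ k → N ℕ.≤ k → (s k - L < ε) × (L - s k < ε)

  field
    archimedean : ∀ x → ∃[ k ] x < k ×ℕ 1#
    complete    : ∀ s → Cauchy s → ∃[ L ] s ⟶ L

  -- The library inverts the difference x - 0#, which is ≈ x.
  inverse : ∀ x → 0# < x → Carrier
  inverse x 0<x = proj₁ (#⇒invertible {x} {0#} (#-sym (<⇒# 0<x)))

  <-cotrans : ∀ {x y} → x < y → ∀ z → x < z ⊎ z < y
  <-cotrans x<y z with #-cotrans (<⇒# x<y) z
  ... | inj₁ x#z with #⇒<⊎> x#z
  ...   | inj₁ x<z = inj₁ x<z
  ...   | inj₂ z<x = inj₂ (IsStrictPartialOrder.trans isStrictPartialOrder z<x x<y)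
  <-cotrans x<y z | inj₂ z#y with #⇒<⊎> z#y
  ...   | inj₁ z<y = inj₂ z<y
  ...   | inj₂ y<z = inj₁ (IsStrictPartialOrder.trans isStrictPartialOrder x<y y<z)

module Matrices {c ℓ₁ ℓ₂ : Level} (ℝ : RealNumbers c ℓ₁ ℓ₂) where
  open RealNumbers ℝ
  open SemiringSum semiring using (sum)

  infix  4 _≈ᴹ_
  infixl 7 _*ᴹ_ _·ᴹ_
  infix  9 _ᵀ

  Matrix : ℕ → Set c
  Matrix d = Fin d → Fin d → Carrier

  _≈ᴹ_ : ∀ {d} → Rel (Matrix d) ℓ₁
  A ≈ᴹ B = ∀ a b → A a b ≈ B a b

  0ᴹ : ∀ {d} → Matrix d
  0ᴹ a b = 0#

  Iᴹ : ∀ {d} → Matrix d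
  Iᴹ a b = if does (a ≟ b) then 1# else 0#

  _*ᴹ_ : ∀ {d} → Matrix d → Matrix d → Matrix d
  (A *ᴹ B) a b = sum (λ k → A a k * B k b)

  _·ᴹ_ : ∀ {d} → Carrier → Matrix d → Matrix d
  (r ·ᴹ A) a b = r * A a b

  _ᵀ : ∀ {d} → Matrix d → Matrix d
  (A ᵀ) a b = A b a

  IsOrthogonal : ∀ {d} → Matrix d → Set ℓ₁
  IsOrthogonal Q = (Q ᵀ *ᴹ Q ≈ᴹ Iᴹ) × (Q *ᴹ Q ᵀ ≈ᴹ Iᴹ)

-- σ x y carries information only when x ~ y; off the edges its value is arbitrary.
record ConnectionGraph {c ℓ₁ ℓ₂ : Level} (ℝ : RealNumbers c ℓ₁ ℓ₂) (n d : ℕ)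
       : Set (lsuc Level.zero ⊔ c ⊔ ℓ₁ ⊔ ℓ₂) where
  open RealNumbers ℝ
  open Matrices ℝ
  infix 4 _~_
  field
    _~_       : Rel (Fin n) Level.zero
    _~?_      : Decidable _~_
    ~-sym     : Symmetric _~_
    ~-irrefl  : ∀ x → ¬ (x ~ x)
    connected : ∀ x y → Star _~_ x y
    w         : Fin n → Fin n → Carrier
    w-sym     : ∀ x y → w x y ≈ w y x
    w-nonneg  : ∀ x y → 0# ≤ w x y
    0<w⇔~     : ∀ x y → (0# < w x y) ⇔ (x ~ y)
    σ         : Fin n → Fin n → Matrix d
    σ-orth    : ∀ {x y} → x ~ y → IsOrthogonal (σ x y)
    σ-sym     : ∀ {x y} → x ~ y → σ y x ≈ᴹ (σ x y) ᵀ

module Voltage {c ℓ₁ ℓ₂ : Level} {ℝ : RealNumbers c ℓ₁ ℓ₂} {n d : ℕ}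
               (G : ConnectionGraph ℝ n d) where
  open RealNumbers ℝ
  open Matrices ℝ
  open ConnectionGraph G
  open SemiringSum semiring using (sum)

  deg : Fin n → Carrier
  deg x = sum (λ y → w x y)

  -- Summing over all y is summing over y ~ x, since w vanishes off the edges.
  ℒ : (Fin n → Matrix d) → (Fin n → Matrix d)
  ℒ f x a b = sum (λ y → w x y * (f x a b - (σ x y *ᴹ f y) a b))

  record IsConnectionVoltage (i j : Fin n) (𝒱 : Fin n → Matrix d) : Set ℓ₁ where
    field
      harmonic : ∀ x → x ≢ i → x ≢ j → ℒ 𝒱 x ≈ᴹ 0ᴹ
      source   : 𝒱 i ≈ᴹ Iᴹ
      sink     : 𝒱 j ≈ᴹ 0ᴹ

  private
    u+v<u⇒v<0 : ∀ {u v} → u + v < u → v < 0#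
    u+v<u⇒v<0 {u} {v} u+v<u =
      <-respˡ-≈ cancel (<-respʳ-≈ (-‿inverseʳ u) (+-monoˡ-< (- u) u+v<u))
      where
      open IsStrictPartialOrder isStrictPartialOrder using (<-respˡ-≈; <-respʳ-≈)
      cancel : (u + v) + - u ≈ v
      cancel = trans (+-congʳ (+-comm u v))
              (trans (+-assoc v u (- u))
              (trans (+-congˡ (-‿inverseʳ u)) (+-identityʳ v)))

    0<+ : ∀ {u v} → 0# < u → 0# ≤ v → 0# < u + v
    0<+ {u} {v} 0<u 0≤v with <-cotrans 0<u (u + v)
    ... | inj₁ 0<u+v = 0<u+v
    ... | inj₂ u+v<u = contradiction (u+v<u⇒v<0 u+v<u) 0≤v

    0≤+ : ∀ {u v} → 0# ≤ u → 0# ≤ v → 0# ≤ u + v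
    0≤+ {u} {v} 0≤u 0≤v u+v<0 with <-cotrans u+v<0 u
    ... | inj₂ u<0   = 0≤u u<0
    ... | inj₁ u+v<u = 0≤v (u+v<u⇒v<0 u+v<u)

    sum-nonneg : ∀ {m} (f : Fin m → Carrier) → (∀ k → 0# ≤ f k) → 0# ≤ sum f
    sum-nonneg {zero}  f 0≤f = IsStrictPartialOrder.irrefl isStrictPartialOrder refl
    sum-nonneg {suc m} f 0≤f = 0≤+ (0≤f zero) (sum-nonneg (λ k → f (suc k)) (λ k → 0≤f (suc k)))

    sum-pos : ∀ {m} (f : Fin m → Carrier) → (∀ k → 0# ≤ f k) → ∀ k → 0# < f k → 0# < sum f
    sum-pos f 0≤f zero    0<fk = 0<+ 0<fk (sum-nonneg (λ k → f (suc k)) (λ k → 0≤f (suc k)))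
    sum-pos f 0≤f (suc k) 0<fk =
      IsStrictPartialOrder.<-respʳ-≈ isStrictPartialOrder (+-comm _ _)
        (0<+ (sum-pos (λ l → f (suc l)) (λ l → 0≤f (suc l)) k 0<fk) (0≤f zero))

    neighbour : ∀ {x y : Fin n} → x ≢ y → Star _~_ x y → ∃[ z ] x ~ z
    neighbour x≢y nil       = contradiction ≡.refl x≢y
    neighbour x≢y (x~z ◅ _) = _ , x~z

    other : ∀ {i j : Fin n} → i ≢ j → ∀ x → ∃[ y ] x ≢ y
    other {i} {j} i≢j x with x ≟ i
    ... | yes x≡i = j , λ x≡j → i≢j (≡.trans (≡.sym x≡i) x≡j)
    ... | no  x≢i = i , x≢i

  deg-pos : ∀ {i j : Fin n} → i ≢ j → ∀ x → 0# < deg x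
  deg-pos i≢j x with other i≢j x
  ... | y , x≢y with neighbour x≢y (connected x y)
  ...   | z , x~z = sum-pos (w x) (w-nonneg x) z (Equivalence.from (0<w⇔~ x z) x~z)

-- The walk has a transition law only if every vertex has positive degree,
-- which holds by deg-pos as soon as the graph has two distinct vertices.
module RandomWalk {c ℓ₁ ℓ₂ : Level} {ℝ : RealNumbers c ℓ₁ ℓ₂} {n d : ℕ}
                  (G : ConnectionGraph ℝ n d)
                  (0<deg : ∀ x → RealNumbers._<_ ℝ (RealNumbers.0# ℝ) (Voltage.deg G x)) where
  open RealNumbers ℝ
  open Matrices ℝ
  open ConnectionGraph G
  open Voltage G using (deg)
  open SemiringSum semiring using (sum)

  transition : Fin n → Fin n → Carrier
  transition x y = w x y * inverse (deg x) (0<deg x)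

  -- pathProbability x (x₁ ∷ … ∷ xₘ) is ℙˣ[X₁ = x₁, …, Xₘ = xₘ].
  pathProbability : ∀ {m} → Fin n → Vec (Fin n) m → Carrier
  pathProbability x []      = 1#
  pathProbability x (y ∷ v) = transition x y * pathProbability y v

  sumVec : ∀ m → (Vec (Fin n) m → Carrier) → Carrier
  sumVec zero    F = F []
  sumVec (suc m) F = sum (λ y → sumVec m (λ v → F (y ∷ v)))

  -- 𝔼ˣ[F(X₀, …, Xₘ)]
  finiteExpectation : ∀ m → Fin n → (Vec (Fin n) (suc m) → Carrier) → Carrier
  finiteExpectation m x F = sumVec m (λ v → pathProbability x v * F (x ∷ v))

  Trajectory : Set
  Trajectory = ℕ → Fin n

  prefix : ∀ m → Trajectory → Vec (Fin n) (suc m)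
  prefix m X = tabulate (λ k → X (toℕ k))

  IsWalkFrom : Fin n → Trajectory → Set
  IsWalkFrom x X = (X 0 ≡ x) × (∀ t → X t ~ X (suc t))

  Event : Set₁
  Event = Trajectory → Set

  -- Variables defined on the event A only; they are extended by 0 off A.
  VariableOn : Event → Set c
  VariableOn A = ∀ X → A X → Carrier

  -- e = 𝔼ˣ[Z ; A] = 𝔼ˣ[Z · 1_A]: the variable Z · 1_A on the space of infinite walks
  -- from x lies between functions L and U of finitely many steps whose
  -- expectations are arbitrarily close to e.  By monotonicity at most one e
  -- qualifies, and it is the integral of Z · 1_A against any probability measure
  -- under which X is the walk started at x.
  IsExpectation : Fin n → (A : Event) → VariableOn A → Carrier → Set (c ⊔ ℓ₂)
  IsExpectation x A Z e = ∀ ε → 0# < ε →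
    ∃[ m ] Σ (Vec (Fin n) (suc m) → Carrier) λ L → Σ (Vec (Fin n) (suc m) → Carrier) λ U →
      (∀ X → IsWalkFrom x X →
         (∀ (a : A X) → (L (prefix m X) ≤ Z X a) × (Z X a ≤ U (prefix m X)))
         × (¬ A X → (L (prefix m X) ≤ 0#) × (0# ≤ U (prefix m X))))
      × (e - ε < finiteExpectation m x L)
      × (finiteExpectation m x U < e + ε)

  IsProbability : Fin n → Event → Carrier → Set (c ⊔ ℓ₂)
  IsProbability x A p = IsExpectation x A (λ _ _ → 1#) p

  IsMatrixExpectation : Fin n → (A : Event) → (∀ X → A X → Matrix d) → Matrix d → Set (c ⊔ ℓ₂)
  IsMatrixExpectation x A Z M = ∀ a b → IsExpectation x A (λ X h → Z X h a b) (M a b)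

  -- C = 𝔼ˣ[Z ∣ A] = 𝔼ˣ[Z ; A] / ℙˣ[A].  Conditioning on a null event is
  -- undefined, so C is then left unconstrained.
  IsConditionalExpectation : Fin n → (A : Event) → (∀ X → A X → Matrix d) → Matrix d → Set (c ⊔ ℓ₁ ⊔ ℓ₂)
  IsConditionalExpectation x A Z C =
    ∃[ p ] Σ (Matrix d) λ M →
      IsProbability x A p
      × IsMatrixExpectation x A Z M
      × ((0<p : 0# < p) → C ≈ᴹ inverse p 0<p ·ᴹ M)

  -- T⁰ₖ = t and T⁰ₖ > t, where T⁰ₖ = inf {t ≥ 0 : X t = k} may be infinite.
  HitsAt : Fin n → Trajectory → ℕ → Set
  HitsAt k X t = (X t ≡ k) × (∀ s → s ℕ.< t → X s ≢ k)

  HitsAfter : Fin n → Trajectory → ℕ → Set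
  HitsAfter k X t = ∀ s → s ℕ.≤ t → X s ≢ k

  T⁰[_]<T⁰[_] : Fin n → Fin n → Event
  T⁰[ i ]<T⁰[ j ] X = ∃[ t ] HitsAt i X t × HitsAfter j X t

  signature : Trajectory → ℕ → Matrix d
  signature X zero    = Iᴹ
  signature X (suc t) = signature X t *ᴹ σ (X t) (X (suc t))

  signatureAtHit : ∀ i j X → T⁰[ i ]<T⁰[ j ] X → Matrix d
  signatureAtHit i j X (t , _) = signature X t

  IsMeanPathSignature : Fin n → Fin n → Fin n → Matrix d → Set (c ⊔ ℓ₁ ⊔ ℓ₂)
  IsMeanPathSignature x i j Ω =
    IsConditionalExpectation x T⁰[ i ]<T⁰[ j ] (signatureAtHit i j) Ω

{-# OPTIONS --safe #-}

-- Let τ be the first time the walk visits i or j. The voltage is matrix-harmonic off {i, j}, so the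
-- voltage at X_{τ ∧ m}, transported back along the path by σ, has expectation 𝒱 x for every m. On
-- {τ ≤ m} this random matrix is the signature when i is hit first and 0 when j is; on {τ > m} it is bounded,
-- because products of orthogonal matrices preserve the norms of columns. Since ℙˣ[τ > m] → 0 (from
-- every vertex some path leads to i, so survival over a fixed number of steps contracts), adding or subtracting a
-- multiple of 1_{τ > m} gives upper and lower functions showing that 𝒱 x = 𝔼ˣ[signature ; Tᵢ < Tⱼ].
-- The scalar analogue gives a Cauchy sequence whose limit is ℙˣ[Tᵢ < Tⱼ]. Expectations are unique,
-- so 𝒱 x = ℙˣ[Tᵢ < Tⱼ] Ω whenever the probability is positive; if it is not, both sides are 0. Equality
-- of reals is stable under double negation, so this case distinction is constructively legitimate.

module Submission where

open import Defs
open import Algebra.Bundles using (CommutativeRing)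
import Algebra.Apartness.Properties.HeytingCommutativeRing as HeytingProperties
import Algebra.Properties.Ring as RingProperties
import Algebra.Properties.Semiring.Mult.TCOptimised as SemiringMult
import Algebra.Properties.Semiring.Sum as SemiringSum
import Algebra.Solver.Ring as RingSolver
open import Algebra.Solver.Ring.AlmostCommutativeRing using (_-Raw-AlmostCommutative⟶_; fromCommutativeRing)
open import Data.Bool.Base using (if_then_else_)
open import Data.Fin.Base using (Fin; zero; suc)
open import Data.Fin.Properties using (_≟_; any?)
open import Data.Integer.Base as ℤ using (ℤ; +_; -[1+_])
import Data.Integer.Properties as ℤ
import Data.Maybe.Base as Maybe
open import Data.Nat.Base as ℕ using (ℕ; zero; suc; z≤n; s≤s)
import Data.Nat.Properties as ℕ
open import Data.Product.Base using (∃; ∃-syntax; _×_; _,_; proj₁; proj₂)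
open import Data.Sum.Base using (_⊎_; inj₁; inj₂; [_,_]′)
open import Data.Vec.Base using (Vec; []; _∷_; tail)
open import Function.Base using (_∘_)
open import Function.Bundles using (module Equivalence)
open import Level using (Level)
open import Relation.Binary.Construct.Closure.ReflexiveTransitive using (Star; _◅_) renaming (ε to nil)
open import Relation.Binary.PropositionalEquality as ≡ using (_≡_; _≢_)
import Relation.Binary.Reasoning.Base.Triple as TripleReasoning
import Relation.Binary.Reasoning.Setoid as ≈-Reasoning
open import Relation.Binary.Structures using (IsStrictPartialOrder; IsPreorder)
open import Relation.Nullary.Decidable.Core using (Dec; yes; no; does; dec⇒maybe; _⊎-dec_)
open import Relation.Nullary.Negation using (¬_; contradiction)

-- Ring solver with integer coefficients.

-- The solver needs coefficients with decidable equality, such as ℤ, in order to cancel x against - x.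
module IntegerSolver {c ℓ} (R : CommutativeRing c ℓ) where
  open CommutativeRing R
  open RingProperties ring
  open SemiringMult semiring using (×1-homo-*) renaming (_×_ to _⨯_)
  open SemiringMult semiring using (×-homo-+; 1+×)
  open ≈-Reasoning setoid

  ⟦_⟧ : ℤ → Carrier
  ⟦ + n ⟧      = n ⨯ 1#
  ⟦ -[1+ n ] ⟧ = - (suc n ⨯ 1#)

  ⟦⟧-homo-- : ∀ k → ⟦ ℤ.- k ⟧ ≈ - ⟦ k ⟧
  ⟦⟧-homo-- (+ zero)    = sym -0#≈0#
  ⟦⟧-homo-- (+ (suc n)) = refl
  ⟦⟧-homo-- -[1+ n ]    = sym (-‿involutive _)

  -- In the successor case `1# - 1#` is inserted between the two terms, and its halves turn `m` and
  -- `n` into their successors.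
  ⟦⟧-⊖ : ∀ m n → ⟦ m ℤ.⊖ n ⟧ ≈ ⟦ + m ⟧ - ⟦ + n ⟧
  ⟦⟧-⊖ zero    zero    = sym (-‿inverseʳ 0#)
  ⟦⟧-⊖ zero    (suc n) = sym (+-identityˡ _)
  ⟦⟧-⊖ (suc m) zero    = sym (trans (+-congˡ -0#≈0#) (+-identityʳ _))
  ⟦⟧-⊖ (suc m) (suc n) = begin
    ⟦ suc m ℤ.⊖ suc n ⟧                   ≡⟨ ≡.cong ⟦_⟧ (ℤ.[1+m]⊖[1+n]≡m⊖n m n) ⟩
    ⟦ m ℤ.⊖ n ⟧                           ≈⟨ ⟦⟧-⊖ m n ⟩
    ⟦ + m ⟧ - ⟦ + n ⟧                     ≈⟨ +-congʳ (+-identityʳ _) ⟨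
    ⟦ + m ⟧ + 0# - ⟦ + n ⟧                ≈⟨ +-congʳ (+-congˡ (-‿inverseʳ 1#)) ⟨
    ⟦ + m ⟧ + (1# - 1#) - ⟦ + n ⟧         ≈⟨ +-congʳ (+-assoc _ _ _) ⟨
    ⟦ + m ⟧ + 1# - 1# - ⟦ + n ⟧           ≈⟨ +-assoc _ _ _ ⟩
    ⟦ + m ⟧ + 1# + (- 1# - ⟦ + n ⟧)       ≈⟨ +-cong (trans (+-comm _ _) (sym (1+× m 1#))) (-‿+-comm _ _) ⟩
    ⟦ + suc m ⟧ - (1# + ⟦ + n ⟧)          ≈⟨ +-congˡ (-‿cong (1+× n 1#)) ⟨
    ⟦ + suc m ⟧ - ⟦ + suc n ⟧             ∎

  ⟦⟧-homo-+ : ∀ k l → ⟦ k ℤ.+ l ⟧ ≈ ⟦ k ⟧ + ⟦ l ⟧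
  ⟦⟧-homo-+ (+ m)    (+ n)    = ×-homo-+ 1# m n
  ⟦⟧-homo-+ (+ m)    -[1+ n ] = ⟦⟧-⊖ m (suc n)
  ⟦⟧-homo-+ -[1+ m ] (+ n)    = trans (⟦⟧-⊖ n (suc m)) (+-comm _ _)
  ⟦⟧-homo-+ -[1+ m ] -[1+ n ] = begin
    - (suc (suc (m ℕ.+ n)) ⨯ 1#)          ≈⟨ -‿cong (1+× (suc (m ℕ.+ n)) 1#) ⟩
    - (1# + (suc m ℕ.+ n) ⨯ 1#)           ≈⟨ -‿cong (+-congˡ (×-homo-+ 1# (suc m) n)) ⟩
    - (1# + (suc m ⨯ 1# + n ⨯ 1#))        ≈⟨ -‿cong (trans (sym (+-assoc _ _ _)) (trans (+-congʳ (+-comm _ _)) (+-assoc _ _ _))) ⟩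
    - (suc m ⨯ 1# + (1# + n ⨯ 1#))        ≈⟨ -‿cong (+-congˡ (1+× n 1#)) ⟨
    - (suc m ⨯ 1# + suc n ⨯ 1#)           ≈⟨ -‿+-comm _ _ ⟨
    ⟦ -[1+ m ] ⟧ + ⟦ -[1+ n ] ⟧           ∎

  ⟦⟧-homo-*⁺ : ∀ m k → ⟦ + m ℤ.* k ⟧ ≈ ⟦ + m ⟧ * ⟦ k ⟧
  ⟦⟧-homo-*⁺ m (+ n) = begin
    ⟦ + m ℤ.* + n ⟧                       ≡⟨ ≡.cong ⟦_⟧ (ℤ.pos-* m n) ⟨
    (m ℕ.* n) ⨯ 1#                        ≈⟨ ×1-homo-* m n ⟩
    ⟦ + m ⟧ * ⟦ + n ⟧                     ∎
  ⟦⟧-homo-*⁺ m -[1+ n ] = begin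
    ⟦ + m ℤ.* -[1+ n ] ⟧                  ≡⟨ ≡.cong ⟦_⟧ (ℤ.neg-distribʳ-* (+ m) (+ suc n)) ⟨
    ⟦ ℤ.- (+ m ℤ.* + suc n) ⟧             ≈⟨ ⟦⟧-homo-- (+ m ℤ.* + suc n) ⟩
    - ⟦ + m ℤ.* + suc n ⟧                 ≈⟨ -‿cong (⟦⟧-homo-*⁺ m (+ suc n)) ⟩
    - (⟦ + m ⟧ * ⟦ + suc n ⟧)             ≈⟨ -‿distribʳ-* _ _ ⟩
    ⟦ + m ⟧ * ⟦ -[1+ n ] ⟧                ∎

  ⟦⟧-homo-* : ∀ k l → ⟦ k ℤ.* l ⟧ ≈ ⟦ k ⟧ * ⟦ l ⟧
  ⟦⟧-homo-* (+ m)    l = ⟦⟧-homo-*⁺ m l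
  ⟦⟧-homo-* -[1+ m ] l = begin
    ⟦ -[1+ m ] ℤ.* l ⟧                    ≡⟨ ≡.cong ⟦_⟧ (ℤ.neg-distribˡ-* (+ suc m) l) ⟨
    ⟦ ℤ.- (+ suc m ℤ.* l) ⟧               ≈⟨ ⟦⟧-homo-- (+ suc m ℤ.* l) ⟩
    - ⟦ + suc m ℤ.* l ⟧                   ≈⟨ -‿cong (⟦⟧-homo-*⁺ (suc m) l) ⟩
    - (⟦ + suc m ⟧ * ⟦ l ⟧)               ≈⟨ -‿distribˡ-* _ _ ⟩
    ⟦ -[1+ m ] ⟧ * ⟦ l ⟧                  ∎

  homomorphism : ℤ.+-*-rawRing -Raw-AlmostCommutative⟶ fromCommutativeRing R
  homomorphism = record
    { ⟦_⟧    = ⟦_⟧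
    ; +-homo = ⟦⟧-homo-+
    ; *-homo = ⟦⟧-homo-*
    ; -‿homo = ⟦⟧-homo--
    ; 0-homo = refl
    ; 1-homo = refl
    }

  open RingSolver ℤ.+-*-rawRing (fromCommutativeRing R) homomorphism
    (λ k l → Maybe.map (reflexive ∘ ≡.cong ⟦_⟧) (dec⇒maybe (k ℤ.≟ l))) public
    using (solve; con; _:=_; _:+_; _:*_; _:-_; :-_)

-- Constructive order and arithmetic of the reals.

module RealProperties {c ℓ₁ ℓ₂ : Level} (ℝ : RealNumbers c ℓ₁ ℓ₂) where
  open RealNumbers ℝ public
  open CommutativeRing commutativeRing public using (ring)
  open RingProperties ring public
    using (-‿distribˡ-*; -‿distribʳ-*; -0#≈0#; -‿involutive)
  open HeytingProperties heytingCommutativeRing public using (1#0; x-0≈x)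
  open IntegerSolver commutativeRing public using (solve; con; _:=_; _:+_; _:*_; _:-_; :-_)
  open IsStrictPartialOrder isStrictPartialOrder public
    using (<-respˡ-≈; <-respʳ-≈; <-resp-≈)
    renaming (irrefl to <-irrefl; trans to <-trans; asym to <-asym)

  ≤-reflexive : ∀ {x y} → x ≈ y → x ≤ y
  ≤-reflexive x≈y y<x = <-irrefl (sym x≈y) y<x

  ≤-refl : ∀ {x} → x ≤ x
  ≤-refl = ≤-reflexive refl

  <⇒≤ : ∀ {x y} → x < y → x ≤ y
  <⇒≤ x<y y<x = <-asym x<y y<x

  -- As `≤` is a negated `<`, cotransitivity does the work: it places `z` relative to `x < y`, and
  -- one of the two outcomes contradicts `y≤z`.
  <-≤-trans : ∀ {x y z} → x < y → y ≤ z → x < z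
  <-≤-trans x<y y≤z with <-cotrans x<y _
  ... | inj₁ x<z = x<z
  ... | inj₂ z<y = contradiction z<y y≤z

  ≤-<-trans : ∀ {x y z} → x ≤ y → y < z → x < z
  ≤-<-trans x≤y y<z with <-cotrans y<z _
  ... | inj₁ y<x = contradiction y<x x≤y
  ... | inj₂ x<z = x<z

  ≤-trans : ∀ {x y z} → x ≤ y → y ≤ z → x ≤ z
  ≤-trans x≤y y≤z z<x = y≤z (<-≤-trans z<x x≤y)

  ≤-isPreorder : IsPreorder _≈_ _≤_
  ≤-isPreorder = record
    { isEquivalence = isEquivalence
    ; reflexive     = ≤-reflexive
    ; trans         = ≤-trans
    }

  module ≤-Reasoning = TripleReasoning ≤-isPreorder <-asym <-trans <-resp-≈ <⇒≤ <-≤-trans ≤-<-trans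
  open ≤-Reasoning

  -- By tightness equality is the negation of apartness, and negations are stable.
  ≈-stable : ∀ {x y} → ¬ ¬ (x ≈ y) → x ≈ y
  ≈-stable {x} {y} ¬¬x≈y = proj₁ (tight x y) (λ x#y → ¬¬x≈y (λ x≈y → proj₂ (tight x y) x≈y x#y))

  ≤-antisym : ∀ {x y} → x ≤ y → y ≤ x → x ≈ y
  ≤-antisym x≤y y≤x = proj₁ (tight _ _) ([ y≤x , x≤y ]′ ∘ #⇒<⊎>)

  -- The constructive remnant of the dichotomy for nonnegative reals. It may be used whenever the
  -- goal is a negation, as `≤` is.
  0≤⇒¬¬0<⊎≈0 : ∀ {x} → 0# ≤ x → ¬ ¬ (0# < x ⊎ x ≈ 0#)
  0≤⇒¬¬0<⊎≈0 0≤x ¬p = ¬p (inj₂ (≤-antisym (¬p ∘ inj₁) 0≤x))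

  +-monoʳ-< : ∀ z {x y} → x < y → z + x < z + y
  +-monoʳ-< z x<y = <-respˡ-≈ (+-comm _ z) (<-respʳ-≈ (+-comm _ z) (+-monoˡ-< z x<y))

  +-monoˡ-≤ : ∀ z {x y} → x ≤ y → x + z ≤ y + z
  +-monoˡ-≤ z {x} {y} x≤y y+z<x+z =
    x≤y (<-respˡ-≈ (cancel y) (<-respʳ-≈ (cancel x) (+-monoˡ-< (- z) y+z<x+z)))
    where
    cancel : ∀ u → (u + z) - z ≈ u
    cancel u = solve 2 (λ u z → (u :+ z) :- z := u) refl u z

  +-monoʳ-≤ : ∀ z {x y} → x ≤ y → z + x ≤ z + y
  +-monoʳ-≤ z {x} {y} x≤y = begin
    z + x ≈⟨ +-comm z x ⟩
    x + z ≤⟨ +-monoˡ-≤ z x≤y ⟩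
    y + z ≈⟨ +-comm y z ⟩
    z + y ∎

  +-mono-≤ : ∀ {x y u v} → x ≤ y → u ≤ v → x + u ≤ y + v
  +-mono-≤ x≤y u≤v = ≤-trans (+-monoˡ-≤ _ x≤y) (+-monoʳ-≤ _ u≤v)

  +-mono-< : ∀ {x y u v} → x < y → u < v → x + u < y + v
  +-mono-< x<y u<v = <-trans (+-monoˡ-< _ x<y) (+-monoʳ-< _ u<v)

  neg-mono-≤ : ∀ {x y} → x ≤ y → - y ≤ - x
  neg-mono-≤ {x} {y} x≤y = begin
    - y             ≈⟨ solve 2 (λ x y → :- y := x :+ (:- x :- y)) refl x y ⟩
    x + (- x - y)   ≤⟨ +-monoˡ-≤ (- x - y) x≤y ⟩
    y + (- x - y)   ≈⟨ solve 2 (λ x y → y :+ (:- x :- y) := :- x) refl x y ⟩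
    - x             ∎

  x<y⇒0<y-x : ∀ {x y} → x < y → 0# < y - x
  x<y⇒0<y-x {x} x<y = <-respˡ-≈ (-‿inverseʳ x) (+-monoˡ-< (- x) x<y)

  x≤y⇒0≤y-x : ∀ {x y} → x ≤ y → 0# ≤ y - x
  x≤y⇒0≤y-x {x} x≤y = ≤-trans (≤-reflexive (sym (-‿inverseʳ x))) (+-monoˡ-≤ (- x) x≤y)

  0≤y-x⇒x≤y : ∀ {x y} → 0# ≤ y - x → x ≤ y
  0≤y-x⇒x≤y {x} {y} 0≤y-x = begin
    x             ≈⟨ +-identityʳ x ⟨
    x + 0#        ≤⟨ +-monoʳ-≤ x 0≤y-x ⟩
    x + (y - x)   ≈⟨ solve 2 (λ x y → x :+ (y :- x) := y) refl x y ⟩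
    y             ∎

  0<y-x⇒x<y : ∀ {x y} → 0# < y - x → x < y
  0<y-x⇒x<y {x} {y} 0<y-x = begin-strict
    x             ≈⟨ +-identityʳ x ⟨
    x + 0#        <⟨ +-monoʳ-< x 0<y-x ⟩
    x + (y - x)   ≈⟨ solve 2 (λ x y → x :+ (y :- x) := y) refl x y ⟩
    y             ∎

  neg-mono-< : ∀ {x y} → x < y → - y < - x
  neg-mono-< {x} {y} x<y = 0<y-x⇒x<y (begin-strict
    0#            <⟨ x<y⇒0<y-x x<y ⟩
    y - x         ≈⟨ solve 2 (λ x y → y :- x := :- x :- (:- y)) refl x y ⟩
    - x - (- y)   ∎)

  x<0⇒0<-x : ∀ {x} → x < 0# → 0# < - x
  x<0⇒0<-x {x} x<0 = <-respʳ-≈ (+-identityˡ (- x)) (x<y⇒0<y-x x<0)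

  0<1 : 0# < 1#
  0<1 with #⇒<⊎> 1#0
  ... | inj₂ 0<1 = 0<1
  -- If `1#` were negative, `- 1#` would be positive, and so would its square, which is `1#`.
  ... | inj₁ 1<0 = begin-strict
    0#          <⟨ *-pos (x<0⇒0<-x 1<0) (x<0⇒0<-x 1<0) ⟩
    - 1# * - 1# ≈⟨ solve 0 (:- con (+ 1) :* :- con (+ 1) := con (+ 1)) refl ⟩
    1#          ∎

  0≤1 : 0# ≤ 1#
  0≤1 = <⇒≤ 0<1

  +-nonneg : ∀ {x y} → 0# ≤ x → 0# ≤ y → 0# ≤ x + y
  +-nonneg 0≤x 0≤y = ≤-trans (≤-reflexive (sym (+-identityˡ 0#))) (+-mono-≤ 0≤x 0≤y)

  +-pos : ∀ {x y} → 0# < x → 0# < y → 0# < x + y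
  +-pos 0<x 0<y = <-respˡ-≈ (+-identityˡ 0#) (+-mono-< 0<x 0<y)

  *-nonneg : ∀ {x y} → 0# ≤ x → 0# ≤ y → 0# ≤ x * y
  *-nonneg {x} {y} 0≤x 0≤y xy<0 =
    0≤⇒¬¬0<⊎≈0 0≤x λ where
      (inj₂ x≈0) → <-irrefl (trans (*-congʳ x≈0) (zeroˡ y)) xy<0
      (inj₁ 0<x) → 0≤⇒¬¬0<⊎≈0 0≤y λ where
        (inj₂ y≈0) → <-irrefl (trans (*-congˡ y≈0) (zeroʳ x)) xy<0
        (inj₁ 0<y) → <-asym (*-pos 0<x 0<y) xy<0

  *-monoˡ-≤ : ∀ {z x y} → 0# ≤ z → x ≤ y → z * x ≤ z * y
  *-monoˡ-≤ {z} {x} {y} 0≤z x≤y = 0≤y-x⇒x≤y (begin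
    0#              ≤⟨ *-nonneg 0≤z (x≤y⇒0≤y-x x≤y) ⟩
    z * (y - x)     ≈⟨ solve 3 (λ x y z → z :* (y :- x) := z :* y :- z :* x) refl x y z ⟩
    z * y - z * x   ∎)

  *-monoˡ-< : ∀ {z x y} → 0# < z → x < y → z * x < z * y
  *-monoˡ-< {z} {x} {y} 0<z x<y = 0<y-x⇒x<y (begin-strict
    0#              <⟨ *-pos 0<z (x<y⇒0<y-x x<y) ⟩
    z * (y - x)     ≈⟨ solve 3 (λ x y z → z :* (y :- x) := z :* y :- z :* x) refl x y z ⟩
    z * y - z * x   ∎)

  *-monoʳ-≤ : ∀ {z x y} → 0# ≤ z → x ≤ y → x * z ≤ y * z
  *-monoʳ-≤ {z} {x} {y} 0≤z x≤y = begin
    x * z ≈⟨ *-comm x z ⟩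
    z * x ≤⟨ *-monoˡ-≤ 0≤z x≤y ⟩
    z * y ≈⟨ *-comm z y ⟩
    y * z ∎

  -- A negative square refutes both `0# ≤ x` and `0# < - x`. The first refutation is a double
  -- negation of `x < 0#`, which the second contradicts.
  square-nonneg : ∀ x → 0# ≤ x * x
  square-nonneg x xx<0 = 0≰x (λ x<0 → 0≮-x (x<0⇒0<-x x<0))
    where
    0≰x : ¬ (0# ≤ x)
    0≰x 0≤x = *-nonneg 0≤x 0≤x xx<0

    0≮-x : ¬ (0# < - x)
    0≮-x 0<-x = <-asym (*-pos 0<-x 0<-x)
      (<-respˡ-≈ (solve 1 (λ x → x :* x := :- x :* :- x) refl x) xx<0)

  square≤⇒≤ : ∀ {x b} → 0# ≤ b → x * x ≤ b * b → x ≤ b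
  square≤⇒≤ {x} {b} 0≤b x²≤b² b<x = x²≤b² (begin-strict
    b * b ≤⟨ *-monoˡ-≤ 0≤b (<⇒≤ b<x) ⟩
    b * x ≈⟨ *-comm b x ⟩
    x * b <⟨ *-monoˡ-< (≤-<-trans 0≤b b<x) b<x ⟩
    x * x ∎)

  square≤⇒-≤ : ∀ {x b} → 0# ≤ b → x * x ≤ b * b → - b ≤ x
  square≤⇒-≤ {x} {b} 0≤b x²≤b² = begin
    - b     ≤⟨ neg-mono-≤ (square≤⇒≤ 0≤b (≤-trans (≤-reflexive eq) x²≤b²)) ⟩
    - - x   ≈⟨ -‿involutive x ⟩
    x       ∎
    where
    eq : - x * - x ≈ x * x
    eq = solve 1 (λ x → :- x :* :- x := x :* x) refl x

  inverse-*ˡ : ∀ {x} (0<x : 0# < x) → inverse x 0<x * x ≈ 1#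
  inverse-*ˡ {x} 0<x =
    trans (*-congˡ (sym (x-0≈x x))) (proj₁ (proj₂ (#⇒invertible {x} {0#} (#-sym (<⇒# 0<x)))))

  inverse-*ʳ : ∀ {x} (0<x : 0# < x) → x * inverse x 0<x ≈ 1#
  inverse-*ʳ 0<x = trans (*-comm _ _) (inverse-*ˡ 0<x)

  inverse-nonneg : ∀ {x} (0<x : 0# < x) → 0# ≤ inverse x 0<x
  inverse-nonneg {x} 0<x inv<0 = <⇒≤ 0<1 (begin-strict
    1#                    ≈⟨ inverse-*ʳ 0<x ⟨
    x * inverse x 0<x     <⟨ *-monoˡ-< 0<x inv<0 ⟩
    x * 0#                ≈⟨ zeroʳ x ⟩
    0#                    ∎)

  -- An invertible element is apart from `0#`, hence positive or negative, and `inverse-nonneg`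
  -- excludes the latter.
  inverse-pos : ∀ {x} (0<x : 0# < x) → 0# < inverse x 0<x
  inverse-pos {x} 0<x with #⇒<⊎> (#-sym inv#0)
    where
    inv#0 : inverse x 0<x # 0#
    inv#0 = HeytingProperties.invertibleˡ⇒# heytingCommutativeRing
      (x , trans (*-congˡ (x-0≈x _)) (inverse-*ʳ 0<x))
  ... | inj₁ 0<inv = 0<inv
  ... | inj₂ inv<0 = contradiction inv<0 (inverse-nonneg 0<x)

  half : ∀ {ε} → 0# < ε → ∃[ δ ] 0# < δ × δ + δ ≈ ε
  half {ε} 0<ε = ½ * ε , *-pos (inverse-pos 0<2) 0<ε , (begin-equality
    ½ * ε + ½ * ε     ≈⟨ solve 2 (λ h e → h :* e :+ h :* e := h :* (con (+ 1) :+ con (+ 1)) :* e) refl ½ ε ⟩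
    ½ * (1# + 1#) * ε ≈⟨ *-congʳ (inverse-*ˡ 0<2) ⟩
    1# * ε            ≈⟨ *-identityˡ ε ⟩
    ε                 ∎)
    where
    0<2 = +-pos 0<1 0<1
    ½ = inverse (1# + 1#) 0<2

-- Finite sums.

module SumProperties {c ℓ₁ ℓ₂ : Level} (ℝ : RealNumbers c ℓ₁ ℓ₂) where
  open RealProperties ℝ
  open SemiringSum semiring public
    using (sum; sum-cong-≋; ∑-distrib-+; ∑-comm; *-distribˡ-sum; *-distribʳ-sum; sum-replicate-zero)

  sum-mono-≤ : ∀ {m} {f g : Fin m → Carrier} → (∀ k → f k ≤ g k) → sum f ≤ sum g
  sum-mono-≤ {zero}  f≤g = ≤-refl
  sum-mono-≤ {suc m} f≤g = +-mono-≤ (f≤g zero) (sum-mono-≤ (f≤g ∘ suc))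

  sum-zero : ∀ {m} {f : Fin m → Carrier} → (∀ k → f k ≈ 0#) → sum f ≈ 0#
  sum-zero {m} f≈0 = trans (sum-cong-≋ f≈0) (sum-replicate-zero m)

  sum-nonneg : ∀ {m} {f : Fin m → Carrier} → (∀ k → 0# ≤ f k) → 0# ≤ sum f
  sum-nonneg {zero}  0≤f = ≤-refl
  sum-nonneg {suc m} 0≤f = +-nonneg (0≤f zero) (sum-nonneg (0≤f ∘ suc))

  term≤sum : ∀ {m} {f : Fin m → Carrier} → (∀ k → 0# ≤ f k) → ∀ k → f k ≤ sum f
  term≤sum {f = f} 0≤f zero = begin
    f zero                    ≈⟨ +-identityʳ _ ⟨
    f zero + 0#               ≤⟨ +-monoʳ-≤ _ (sum-nonneg (0≤f ∘ suc)) ⟩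
    f zero + sum (f ∘ suc)    ∎
    where open ≤-Reasoning
  term≤sum {f = f} 0≤f (suc k) = begin
    f (suc k)                 ≤⟨ term≤sum (0≤f ∘ suc) k ⟩
    sum (f ∘ suc)             ≈⟨ +-identityˡ _ ⟨
    0# + sum (f ∘ suc)        ≤⟨ +-monoˡ-≤ _ (0≤f zero) ⟩
    f zero + sum (f ∘ suc)    ∎
    where open ≤-Reasoning

-- Matrix algebra and column norms.

module MatrixProperties {c ℓ₁ ℓ₂ : Level} (ℝ : RealNumbers c ℓ₁ ℓ₂) where
  open RealProperties ℝ
  open SumProperties ℝ
  open Matrices ℝ

  ≈ᴹ-sym : ∀ {d} {A B : Matrix d} → A ≈ᴹ B → B ≈ᴹ A
  ≈ᴹ-sym A≈B a b = sym (A≈B a b)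

  ≈ᴹ-trans : ∀ {d} {A B C : Matrix d} → A ≈ᴹ B → B ≈ᴹ C → A ≈ᴹ C
  ≈ᴹ-trans A≈B B≈C a b = trans (A≈B a b) (B≈C a b)

  *ᴹ-cong : ∀ {d} {A A′ B B′ : Matrix d} → A ≈ᴹ A′ → B ≈ᴹ B′ → A *ᴹ B ≈ᴹ A′ *ᴹ B′
  *ᴹ-cong A≈A′ B≈B′ a b = sum-cong-≋ (λ k → *-cong (A≈A′ a k) (B≈B′ k b))

  *ᴹ-congˡ : ∀ {d} (A : Matrix d) {B B′ : Matrix d} → B ≈ᴹ B′ → A *ᴹ B ≈ᴹ A *ᴹ B′
  *ᴹ-congˡ A = *ᴹ-cong {A = A} (λ _ _ → refl)

  *ᴹ-congʳ : ∀ {d} {A A′ : Matrix d} (B : Matrix d) → A ≈ᴹ A′ → A *ᴹ B ≈ᴹ A′ *ᴹ B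
  *ᴹ-congʳ B A≈A′ = *ᴹ-cong {B = B} A≈A′ (λ _ _ → refl)

  *ᴹ-assoc : ∀ {d} (A B C : Matrix d) → (A *ᴹ B) *ᴹ C ≈ᴹ A *ᴹ (B *ᴹ C)
  *ᴹ-assoc A B C a b = begin-equality
    sum (λ k → sum (λ l → A a l * B l k) * C k b)     ≈⟨ sum-cong-≋ (λ k → *-distribʳ-sum (C k b) (λ l → A a l * B l k)) ⟩
    sum (λ k → sum (λ l → A a l * B l k * C k b))     ≈⟨ ∑-comm (λ k l → A a l * B l k * C k b) ⟩
    sum (λ l → sum (λ k → A a l * B l k * C k b))     ≈⟨ sum-cong-≋ (λ l → sum-cong-≋ (λ k → *-assoc (A a l) (B l k) (C k b))) ⟩
    sum (λ l → sum (λ k → A a l * (B l k * C k b)))   ≈⟨ sum-cong-≋ (λ l → *-distribˡ-sum (A a l) (λ k → B l k * C k b)) ⟨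
    sum (λ l → A a l * sum (λ k → B l k * C k b))     ∎
    where open ≤-Reasoning

  *ᴹ-zeroʳ : ∀ {d} (A : Matrix d) → A *ᴹ 0ᴹ ≈ᴹ 0ᴹ
  *ᴹ-zeroʳ A a b = sum-zero (λ k → zeroʳ (A a k))

  Iᴹ-sym : ∀ {d} → Iᴹ {d} ᵀ ≈ᴹ Iᴹ
  Iᴹ-sym a b with a ≟ b | b ≟ a
  ... | yes _   | yes _   = refl
  ... | no _    | no _    = refl
  ... | yes a≡b | no b≢a  = contradiction (≡.sym a≡b) b≢a
  ... | no a≢b  | yes b≡a = contradiction (≡.sym b≡a) a≢b

  sum-Iᴹ : ∀ {d} (a : Fin d) (f : Fin d → Carrier) → sum (λ k → Iᴹ a k * f k) ≈ f a
  sum-Iᴹ zero    f = trans (+-cong (*-identityˡ _) (sum-zero (λ k → zeroˡ (f (suc k))))) (+-identityʳ _)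
  -- `does (suc a ≟ suc k)` computes to `does (a ≟ k)`, so the tail is the same sum one index lower.
  sum-Iᴹ (suc a) f = trans (+-cong (zeroˡ _) (sum-Iᴹ a (f ∘ suc))) (+-identityˡ _)

  *ᴹ-identityˡ : ∀ {d} (A : Matrix d) → Iᴹ *ᴹ A ≈ᴹ A
  *ᴹ-identityˡ A a b = sum-Iᴹ a (λ k → A k b)

  *ᴹ-identityʳ : ∀ {d} (A : Matrix d) → A *ᴹ Iᴹ ≈ᴹ A
  *ᴹ-identityʳ A a b = trans
    (sum-cong-≋ (λ k → trans (*-comm (A a k) (Iᴹ k b)) (*-congʳ (Iᴹ-sym b k))))
    (sum-Iᴹ b (A a))

  columnNormSq : ∀ {d} → Fin d → Matrix d → Carrier
  columnNormSq b A = sum (λ a → A a b * A a b)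

  columnNormSq-cong : ∀ {d} (b : Fin d) {A B : Matrix d} → A ≈ᴹ B → columnNormSq b A ≈ columnNormSq b B
  columnNormSq-cong b A≈B = sum-cong-≋ (λ a → *-cong (A≈B a b) (A≈B a b))

  columnNormSq-Iᴹ : ∀ {d} (b : Fin d) → columnNormSq b Iᴹ ≈ 1#
  columnNormSq-Iᴹ b = trans (sum-cong-≋ (λ a → *-congʳ (Iᴹ-sym b a))) (trans (sum-Iᴹ b (λ a → Iᴹ a b)) Ibb≈1)
    where
    Ibb≈1 : Iᴹ b b ≈ 1#
    Ibb≈1 with b ≟ b
    ... | yes _  = refl
    ... | no b≢b = contradiction ≡.refl b≢b

  -- The squared norm of column `b` of `M` is the diagonal entry of `M ᵀ *ᴹ M` at `b`, and
  -- `Q ᵀ *ᴹ Q` cancels inside this product for `Q *ᴹ A`.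
  columnNormSq-orthogonal : ∀ {d} {Q : Matrix d} → IsOrthogonal Q →
    ∀ b (A : Matrix d) → columnNormSq b (Q *ᴹ A) ≈ columnNormSq b A
  columnNormSq-orthogonal {Q = Q} (QᵀQ≈I , _) b A = begin-equality
    ((Q *ᴹ A) ᵀ *ᴹ (Q *ᴹ A)) b b        ≈⟨ *ᴹ-congʳ (Q *ᴹ A) transpose b b ⟩
    ((A ᵀ *ᴹ Q ᵀ) *ᴹ (Q *ᴹ A)) b b      ≈⟨ *ᴹ-assoc (A ᵀ) (Q ᵀ) (Q *ᴹ A) b b ⟩
    (A ᵀ *ᴹ (Q ᵀ *ᴹ (Q *ᴹ A))) b b      ≈⟨ *ᴹ-congˡ (A ᵀ) (*ᴹ-assoc (Q ᵀ) Q A) b b ⟨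
    (A ᵀ *ᴹ ((Q ᵀ *ᴹ Q) *ᴹ A)) b b      ≈⟨ *ᴹ-congˡ (A ᵀ) (≈ᴹ-trans (*ᴹ-congʳ A QᵀQ≈I) (*ᴹ-identityˡ A)) b b ⟩
    (A ᵀ *ᴹ A) b b                      ∎
    where
    open ≤-Reasoning
    transpose : (Q *ᴹ A) ᵀ ≈ᴹ A ᵀ *ᴹ Q ᵀ
    transpose k l = sum-cong-≋ (λ m → *-comm (Q l m) (A m k))

  square≤columnNormSq : ∀ {d} (A : Matrix d) a b → A a b * A a b ≤ columnNormSq b A
  square≤columnNormSq A a b = term≤sum (λ k → square-nonneg (A k b)) a

-- One-step averages, finite expectations and uniqueness of expectations.

module WalkProperties {c ℓ₁ ℓ₂ : Level} {ℝ : RealNumbers c ℓ₁ ℓ₂} {n d : ℕ} (G : ConnectionGraph ℝ n d)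
                      (0<deg : ∀ x → RealNumbers._<_ ℝ (RealNumbers.0# ℝ) (Voltage.deg G x)) where
  open RealProperties ℝ
  open SumProperties ℝ
  open Matrices ℝ
  open ConnectionGraph G
  open Voltage G using (deg)
  open RandomWalk G 0<deg
  open ≤-Reasoning

  w≈0 : ∀ {x y} → ¬ (x ~ y) → w x y ≈ 0#
  w≈0 {x} {y} x≁y = ≤-antisym (x≁y ∘ Equivalence.to (0<w⇔~ x y)) (w-nonneg x y)

  -- All weights at an isolated vertex vanish, so its degree would be 0.
  neighbour : ∀ x → ∃[ y ] x ~ y
  neighbour x with any? (x ~?_)
  ... | yes x~y     = x~y
  ... | no isolated = contradiction (0<deg x) (≤-reflexive (sum-zero (λ y → w≈0 (λ x~y → isolated (y , x~y)))))

  transition-nonneg : ∀ x y → 0# ≤ transition x y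
  transition-nonneg x y = *-nonneg (w-nonneg x y) (inverse-nonneg (0<deg x))

  transition-pos : ∀ {x y} → x ~ y → 0# < transition x y
  transition-pos {x} {y} x~y = *-pos (Equivalence.from (0<w⇔~ x y) x~y) (inverse-pos (0<deg x))

  transition≈0 : ∀ {x y} → ¬ (x ~ y) → transition x y ≈ 0#
  transition≈0 x≁y = trans (*-congʳ (w≈0 x≁y)) (zeroˡ _)

  sum-transition : ∀ x → sum (transition x) ≈ 1#
  sum-transition x = trans (sym (*-distribʳ-sum (inverse (deg x) (0<deg x)) (w x))) (inverse-*ʳ (0<deg x))

  average : Fin n → (Fin n → Carrier) → Carrier
  average x f = sum (λ y → transition x y * f y)

  average-cong : ∀ x {f g} → (∀ y → f y ≈ g y) → average x f ≈ average x g
  average-cong x f≈g = sum-cong-≋ (λ y → *-congˡ (f≈g y))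

  -- Off the edges the weight is 0, so inequalities along edges suffice. This is what admits
  -- comparisons made only along genuine walks.
  average-mono : ∀ x {f g} → (∀ y → x ~ y → f y ≤ g y) → average x f ≤ average x g
  average-mono x {f} {g} f≤g = sum-mono-≤ term
    where
    term : ∀ y → transition x y * f y ≤ transition x y * g y
    term y with x ~? y
    ... | yes x~y = *-monoˡ-≤ (transition-nonneg x y) (f≤g y x~y)
    ... | no  x≁y = ≤-reflexive (trans (vanishes (f y)) (sym (vanishes (g y))))
      where
      vanishes : ∀ r → transition x y * r ≈ 0#
      vanishes r = trans (*-congʳ (transition≈0 x≁y)) (zeroˡ r)

  average-const : ∀ x r → average x (λ _ → r) ≈ r
  average-const x r = begin-equality
    average x (λ _ → r)         ≈⟨ *-distribʳ-sum r (transition x) ⟨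
    sum (transition x) * r      ≈⟨ *-congʳ (sum-transition x) ⟩
    1# * r                      ≈⟨ *-identityˡ r ⟩
    r                           ∎

  average-linear : ∀ x f r g → average x (λ y → f y + r * g y) ≈ average x f + r * average x g
  average-linear x f r g = begin-equality
    average x (λ y → f y + r * g y)
      ≈⟨ sum-cong-≋ (λ y → solve 4 (λ p f r g → p :* (f :+ r :* g) := p :* f :+ r :* (p :* g)) refl
                             (transition x y) (f y) r (g y)) ⟩
    sum (λ y → transition x y * f y + r * (transition x y * g y))
      ≈⟨ ∑-distrib-+ (λ y → transition x y * f y) (λ y → r * (transition x y * g y)) ⟩
    average x f + sum (λ y → r * (transition x y * g y))
      ≈⟨ +-congˡ (*-distribˡ-sum r (λ y → transition x y * g y)) ⟨
    average x f + r * average x g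
      ∎

  sumVec-cong : ∀ m {F H : Vec (Fin n) m → Carrier} → (∀ v → F v ≈ H v) → sumVec m F ≈ sumVec m H
  sumVec-cong zero    F≈H = F≈H []
  sumVec-cong (suc m) F≈H = sum-cong-≋ (λ y → sumVec-cong m (F≈H ∘ (y ∷_)))

  *-distribˡ-sumVec : ∀ m r (F : Vec (Fin n) m → Carrier) → r * sumVec m F ≈ sumVec m (λ v → r * F v)
  *-distribˡ-sumVec zero    r F = refl
  *-distribˡ-sumVec (suc m) r F = trans
    (*-distribˡ-sum r (λ y → sumVec m (F ∘ (y ∷_))))
    (sum-cong-≋ (λ y → *-distribˡ-sumVec m r (F ∘ (y ∷_))))

  finiteExpectation-cong : ∀ m x (F H : Vec (Fin n) (suc m) → Carrier) → (∀ v → F (x ∷ v) ≈ H (x ∷ v)) →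
    finiteExpectation m x F ≈ finiteExpectation m x H
  finiteExpectation-cong m x F H F≈H = sumVec-cong m (λ v → *-congˡ (F≈H v))

  finiteExpectation-zero : ∀ x F → finiteExpectation 0 x F ≈ F (x ∷ [])
  finiteExpectation-zero x F = *-identityˡ _

  -- First-step analysis: the factor for the first transition is pulled out of the sum over the
  -- remaining path.
  finiteExpectation-suc : ∀ m x F →
    finiteExpectation (suc m) x F ≈ average x (λ y → finiteExpectation m y (F ∘ (x ∷_)))
  finiteExpectation-suc m x F = sum-cong-≋ (λ y → trans
    (sumVec-cong m (λ v → *-assoc (transition x y) (pathProbability y v) (F (x ∷ y ∷ v))))
    (sym (*-distribˡ-sumVec m (transition x y) (λ v → pathProbability y v * F (x ∷ y ∷ v)))))

  finiteExpectation-const : ∀ m x r → finiteExpectation m x (λ _ → r) ≈ r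
  finiteExpectation-const zero    x r = finiteExpectation-zero x (λ _ → r)
  finiteExpectation-const (suc m) x r = begin-equality
    finiteExpectation (suc m) x (λ _ → r)                     ≈⟨ finiteExpectation-suc m x (λ _ → r) ⟩
    average x (λ y → finiteExpectation m y (λ _ → r))         ≈⟨ average-cong x (λ y → finiteExpectation-const m y r) ⟩
    average x (λ _ → r)                                       ≈⟨ average-const x r ⟩
    r                                                         ∎

  finiteExpectation-linear : ∀ m x F r H →
    finiteExpectation m x (λ v → F v + r * H v) ≈ finiteExpectation m x F + r * finiteExpectation m x H
  finiteExpectation-linear zero    x F r H = begin-equality
    finiteExpectation 0 x (λ v → F v + r * H v)               ≈⟨ finiteExpectation-zero x (λ v → F v + r * H v) ⟩
    F (x ∷ []) + r * H (x ∷ [])                               ≈⟨ +-cong (finiteExpectation-zero x F) (*-congˡ (finiteExpectation-zero x H)) ⟨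
    finiteExpectation 0 x F + r * finiteExpectation 0 x H     ∎
  finiteExpectation-linear (suc m) x F r H = begin-equality
    finiteExpectation (suc m) x (λ v → F v + r * H v)
      ≈⟨ finiteExpectation-suc m x (λ v → F v + r * H v) ⟩
    average x (λ y → finiteExpectation m y (λ v → F (x ∷ v) + r * H (x ∷ v)))
      ≈⟨ average-cong x (λ y → finiteExpectation-linear m y (F ∘ (x ∷_)) r (H ∘ (x ∷_))) ⟩
    average x (λ y → finiteExpectation m y (F ∘ (x ∷_)) + r * finiteExpectation m y (H ∘ (x ∷_)))
      ≈⟨ average-linear x (λ y → finiteExpectation m y (F ∘ (x ∷_))) r (λ y → finiteExpectation m y (H ∘ (x ∷_))) ⟩
    average x (λ y → finiteExpectation m y (F ∘ (x ∷_))) + r * average x (λ y → finiteExpectation m y (H ∘ (x ∷_)))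
      ≈⟨ +-cong (finiteExpectation-suc m x F) (*-congˡ (finiteExpectation-suc m x H)) ⟨
    finiteExpectation (suc m) x F + r * finiteExpectation (suc m) x H
      ∎

  IsWalk : Trajectory → Set
  IsWalk X = ∀ t → X t ~ X (suc t)

  infixr 5 _◂_
  _◂_ : Fin n → Trajectory → Trajectory
  (x ◂ X) zero    = x
  (x ◂ X) (suc t) = X t

  ◂-walk : ∀ {x y X} → x ~ y → IsWalkFrom y X → IsWalkFrom x (x ◂ X)
  ◂-walk {x} {X = X} x~y (X₀≡y , steps) = ≡.refl , λ where
    zero    → ≡.subst (x ~_) (≡.sym X₀≡y) x~y
    (suc t) → steps t

  -- Comparisons below are assumed only along infinite walks, so extracting an inequality between
  -- 0-step values takes an actual walk from `x`.
  someWalk : Fin n → Trajectory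
  someWalk x zero    = x
  someWalk x (suc t) = proj₁ (neighbour (someWalk x t))

  someWalk-walk : ∀ x → IsWalkFrom x (someWalk x)
  someWalk-walk x = ≡.refl , λ t → proj₂ (neighbour (someWalk x t))

  -- The two functions may look at different numbers of steps: only their values along infinite walks matter.
  finiteExpectation-mono : ∀ m m′ x (F : Vec (Fin n) (suc m) → Carrier) (H : Vec (Fin n) (suc m′) → Carrier) →
    (∀ X → IsWalkFrom x X → F (prefix m X) ≤ H (prefix m′ X)) →
    finiteExpectation m x F ≤ finiteExpectation m′ x H
  finiteExpectation-mono zero zero x F H F≤H = begin
    finiteExpectation 0 x F     ≈⟨ finiteExpectation-zero x F ⟩
    F (x ∷ [])                  ≤⟨ F≤H (someWalk x) (someWalk-walk x) ⟩
    H (x ∷ [])                  ≈⟨ finiteExpectation-zero x H ⟨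
    finiteExpectation 0 x H     ∎
  -- A value fixed at time 0 equals its own average over the first step, so both sides can be
  -- restarted from a neighbour.
  finiteExpectation-mono zero (suc m′) x F H F≤H = begin
    finiteExpectation 0 x F
      ≈⟨ finiteExpectation-zero x F ⟩
    F (x ∷ [])
      ≈⟨ average-const x (F (x ∷ [])) ⟨
    average x (λ _ → F (x ∷ []))
      ≈⟨ average-cong x (λ y → finiteExpectation-zero y (λ _ → F (x ∷ []))) ⟨
    average x (λ y → finiteExpectation 0 y (λ _ → F (x ∷ [])))
      ≤⟨ average-mono x (λ y x~y → finiteExpectation-mono zero m′ y (λ _ → F (x ∷ [])) (H ∘ (x ∷_))
          (λ X walk → F≤H (x ◂ X) (◂-walk x~y walk))) ⟩
    average x (λ y → finiteExpectation m′ y (H ∘ (x ∷_)))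
      ≈⟨ finiteExpectation-suc m′ x H ⟨
    finiteExpectation (suc m′) x H
      ∎
  finiteExpectation-mono (suc m) zero x F H F≤H = begin
    finiteExpectation (suc m) x F
      ≈⟨ finiteExpectation-suc m x F ⟩
    average x (λ y → finiteExpectation m y (F ∘ (x ∷_)))
      ≤⟨ average-mono x (λ y x~y → finiteExpectation-mono m zero y (F ∘ (x ∷_)) (λ _ → H (x ∷ []))
          (λ X walk → F≤H (x ◂ X) (◂-walk x~y walk))) ⟩
    average x (λ y → finiteExpectation 0 y (λ _ → H (x ∷ [])))
      ≈⟨ average-cong x (λ y → finiteExpectation-zero y (λ _ → H (x ∷ []))) ⟩
    average x (λ _ → H (x ∷ []))
      ≈⟨ average-const x (H (x ∷ [])) ⟩
    H (x ∷ [])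
      ≈⟨ finiteExpectation-zero x H ⟨
    finiteExpectation 0 x H
      ∎
  finiteExpectation-mono (suc m) (suc m′) x F H F≤H = begin
    finiteExpectation (suc m) x F
      ≈⟨ finiteExpectation-suc m x F ⟩
    average x (λ y → finiteExpectation m y (F ∘ (x ∷_)))
      ≤⟨ average-mono x (λ y x~y → finiteExpectation-mono m m′ y (F ∘ (x ∷_)) (H ∘ (x ∷_))
          (λ X walk → F≤H (x ◂ X) (◂-walk x~y walk))) ⟩
    average x (λ y → finiteExpectation m′ y (H ∘ (x ∷_)))
      ≈⟨ finiteExpectation-suc m′ x H ⟨
    finiteExpectation (suc m′) x H
      ∎

  -- L ≤ Z · 1_A ≤ U on the walks from x, as in IsExpectation.
  Brackets : Fin n → (A : Event) → VariableOn A → ∀ {m} → (L U : Vec (Fin n) (suc m) → Carrier) → Set ℓ₂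
  Brackets x A Z {m} L U = ∀ X → IsWalkFrom x X →
    (∀ (a : A X) → (L (prefix m X) ≤ Z X a) × (Z X a ≤ U (prefix m X)))
    × (¬ A X → (L (prefix m X) ≤ 0#) × (0# ≤ U (prefix m X)))

  -- Along each walk both functions compare with `Z` on `A` and with `0#` off `A`. The event may be
  -- undecidable, but the goal is a negation, so the two cases can be refuted in turn.
  brackets-≤ : ∀ {x A Z m m′} {L U : Vec (Fin n) (suc m) → Carrier} {L′ U′ : Vec (Fin n) (suc m′) → Carrier} →
    Brackets x A Z L U → Brackets x A Z L′ U′ →
    finiteExpectation m x L ≤ finiteExpectation m′ x U′
  brackets-≤ {x} {A} {m = m} {m′} {L} {U} {L′} {U′} LZU LZU′ = finiteExpectation-mono m m′ x L U′ pointwise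
    where
    pointwise : ∀ X → IsWalkFrom x X → L (prefix m X) ≤ U′ (prefix m′ X)
    pointwise X walk U′<L = ¬¬A (λ a → ≤-trans (proj₁ (proj₁ (LZU X walk) a)) (proj₂ (proj₁ (LZU′ X walk) a)) U′<L)
      where
      ¬¬A : ¬ ¬ A X
      ¬¬A ¬a = ≤-trans (proj₁ (proj₂ (LZU X walk) ¬a)) (proj₂ (proj₂ (LZU′ X walk) ¬a)) U′<L

  expectation-≤ : ∀ {x A Z e e′} → IsExpectation x A Z e → IsExpectation x A Z e′ → e ≤ e′
  expectation-≤ {x} {A} {Z} {e} {e′} E E′ e′<e =
    -- With half of the gap as tolerance, `e′ + δ` equals `e - δ`, so an upper expectation would
    -- fall below a lower one.
    let δ , 0<δ , δ+δ≈e-e′ = half (x<y⇒0<y-x e′<e)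
        m , L , U , LZU , e-δ<L , _ = E δ 0<δ
        m′ , L′ , U′ , LZU′ , _ , U′<e′+δ = E′ δ 0<δ
    in brackets-≤ {x} {A} {Z} {L = L} {U} {L′} {U′} LZU LZU′ (begin-strict
      finiteExpectation m′ x U′   <⟨ U′<e′+δ ⟩
      e′ + δ                      ≈⟨ solve 2 (λ e d → e :+ d := e :+ (d :+ d) :- d) refl e′ δ ⟩
      e′ + (δ + δ) - δ            ≈⟨ +-congʳ (+-congˡ δ+δ≈e-e′) ⟩
      e′ + (e - e′) - δ           ≈⟨ solve 3 (λ e e′ d → e′ :+ (e :- e′) :- d := e :- d) refl e e′ δ ⟩
      e - δ                       <⟨ e-δ<L ⟩
      finiteExpectation m x L     ∎)

  expectation-unique : ∀ {x A Z e e′} → IsExpectation x A Z e → IsExpectation x A Z e′ → e ≈ e′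
  expectation-unique E E′ = ≤-antisym (expectation-≤ E E′) (expectation-≤ E′ E)

-- Decreasing and contracting sequences.

module SequenceProperties {c ℓ₁ ℓ₂ : Level} (ℝ : RealNumbers c ℓ₁ ℓ₂) where
  open RealProperties ℝ
  open ≤-Reasoning

  ×ℕ1-nonneg : ∀ k → 0# ≤ k ×ℕ 1#
  ×ℕ1-nonneg zero    = ≤-refl
  ×ℕ1-nonneg (suc k) = +-nonneg 0≤1 (×ℕ1-nonneg k)

  antitone : ∀ {u : ℕ → Carrier} → (∀ k → u (suc k) ≤ u k) → ∀ k l → u (k ℕ.+ l) ≤ u l
  antitone dec zero    l = ≤-refl
  antitone dec (suc k) l = ≤-trans (dec (k ℕ.+ l)) (antitone dec k l)

  antitone-≤ : ∀ {u : ℕ → Carrier} → (∀ k → u (suc k) ≤ u k) → ∀ {k l} → k ℕ.≤ l → u l ≤ u k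
  antitone-≤ {u} dec {k} {l} k≤l =
    ≡.subst (λ m → u m ≤ u k) (ℕ.m∸n+n≡m k≤l) (antitone dec (l ℕ.∸ k) k)

  -- Induction on the number of sequences. A later index keeps every gap because the sequences
  -- decrease, and the product of two gaps that are at most 1 lies below both, standing in for their
  -- minimum.
  uniform-gap : ∀ {m} (u : Fin m → ℕ → Carrier) → (∀ x k → u x (suc k) ≤ u x k) →
    (∀ x → ∃[ N ] ∃[ δ ] 0# < δ × δ ≤ 1# × u x N + δ ≤ 1#) →
    ∃[ N ] ∃[ δ ] 0# < δ × δ ≤ 1# × (∀ x → u x N + δ ≤ 1#)
  uniform-gap {zero}  u dec gap = 0 , 1# , 0<1 , ≤-refl , λ ()
  uniform-gap {suc m} u dec gap =
    let N , δ , 0<δ , δ≤1 , gap₀ = gap zero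
        M , γ , 0<γ , γ≤1 , gapₛ = uniform-gap (u ∘ suc) (dec ∘ suc) (gap ∘ suc)
        δγ≤δ : δ * γ ≤ δ
        δγ≤δ = ≤-trans (*-monoˡ-≤ (<⇒≤ 0<δ) γ≤1) (≤-reflexive (*-identityʳ δ))
        δγ≤γ : δ * γ ≤ γ
        δγ≤γ = ≤-trans (*-monoʳ-≤ (<⇒≤ 0<γ) δ≤1) (≤-reflexive (*-identityˡ γ))
    in N ℕ.+ M , δ * γ , *-pos 0<δ 0<γ , ≤-trans δγ≤δ δ≤1 , λ where
         zero    → ≤-trans (+-mono-≤ (antitone-≤ (dec zero) (ℕ.m≤m+n N M)) δγ≤δ) gap₀
         (suc x) → ≤-trans (+-mono-≤ (antitone-≤ (dec (suc x)) (ℕ.m≤n+m M N)) δγ≤γ) (gapₛ x)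

  -- Bernoulli's inequality in disguise: a k is at most (1 - δ)ᵏ, and only 1 / (1 + k δ) is needed.
  contraction-bound : ∀ {δ} {a : ℕ → Carrier} → 0# ≤ δ → (∀ k → 0# ≤ a k) → a 0 ≤ 1# →
    (∀ k → a (suc k) + δ * a k ≤ a k) → ∀ k → (1# + (k ×ℕ 1#) * δ) * a k ≤ 1#
  contraction-bound {δ} {a} 0≤δ 0≤a a₀≤1 step zero = begin
    (1# + 0# * δ) * a 0     ≈⟨ solve 2 (λ d a → (con (+ 1) :+ con (+ 0) :* d) :* a := a) refl δ (a 0) ⟩
    a 0                     ≤⟨ a₀≤1 ⟩
    1#                      ∎
  contraction-bound {δ} {a} 0≤δ 0≤a a₀≤1 step (suc k) = begin
    (1# + (1# + K) * δ) * a′          ≈⟨ solve 3 (λ d K a′ → (con (+ 1) :+ (con (+ 1) :+ K) :* d) :* a′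
                                                              := (con (+ 1) :+ K :* d) :* a′ :+ d :* a′) refl δ K a′ ⟩
    -- The extra `δ * a′` is raised to `δ * a k` and then multiplied by `1# + K * δ`, which is at
    -- least 1, so that `step k` applies to the common factor.
    (1# + K * δ) * a′ + δ * a′        ≤⟨ +-monoʳ-≤ _ (*-monoˡ-≤ 0≤δ a′≤a) ⟩
    (1# + K * δ) * a′ + δ * a k       ≤⟨ +-monoʳ-≤ _ (≤-trans (≤-reflexive (sym (*-identityˡ _))) (*-monoʳ-≤ 0≤δa 1≤1+Kδ)) ⟩
    (1# + K * δ) * a′ + (1# + K * δ) * (δ * a k)
                                      ≈⟨ distribˡ _ _ _ ⟨
    (1# + K * δ) * (a′ + δ * a k)     ≤⟨ *-monoˡ-≤ (≤-trans 0≤1 1≤1+Kδ) (step k) ⟩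
    (1# + K * δ) * a k                ≤⟨ contraction-bound 0≤δ 0≤a a₀≤1 step k ⟩
    1#                                ∎
    where
    K  = k ×ℕ 1#
    a′ = a (suc k)
    0≤δa : 0# ≤ δ * a k
    0≤δa = *-nonneg 0≤δ (0≤a k)
    a′≤a : a′ ≤ a k
    a′≤a = begin
      a′              ≈⟨ +-identityʳ a′ ⟨
      a′ + 0#         ≤⟨ +-monoʳ-≤ a′ 0≤δa ⟩
      a′ + δ * a k    ≤⟨ step k ⟩
      a k             ∎
    1≤1+Kδ : 1# ≤ 1# + K * δ
    1≤1+Kδ = begin
      1#            ≈⟨ +-identityʳ 1# ⟨
      1# + 0#       ≤⟨ +-monoʳ-≤ 1# (*-nonneg (×ℕ1-nonneg k) 0≤δ) ⟩
      1# + K * δ    ∎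

  contraction-vanishes : ∀ {δ} {a : ℕ → Carrier} → 0# < δ → (∀ k → 0# ≤ a k) → a 0 ≤ 1# →
    (∀ k → a (suc k) + δ * a k ≤ a k) → ∀ ε → 0# < ε → ∃[ k ] a k < ε
  contraction-vanishes {δ} {a} 0<δ 0≤a a₀≤1 step ε 0<ε =
    let η , 0<η , η+η≈ε = half 0<ε
        0<δη = *-pos 0<δ 0<η
        -- `k` exceeds `1 / (δ η)`: were `a k` above `η`, this would give
        -- `1 < k δ η ≤ (1 + k δ) a k ≤ 1`. Since `η` is half of `ε`, the bound `a k ≤ η` is strict
        -- against `ε`.
        k , inv<k = archimedean (inverse (δ * η) 0<δη)
        K = k ×ℕ 1#
        0≤Kδ = *-nonneg (×ℕ1-nonneg k) (<⇒≤ 0<δ)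
        aₖ≤η : a k ≤ η
        aₖ≤η = λ η<aₖ → contraction-bound (<⇒≤ 0<δ) 0≤a a₀≤1 step k (begin-strict
          1#                            ≈⟨ inverse-*ʳ 0<δη ⟨
          δ * η * inverse (δ * η) 0<δη  <⟨ *-monoˡ-< 0<δη inv<k ⟩
          δ * η * K                     ≈⟨ solve 3 (λ d e K → d :* e :* K := K :* d :* e) refl δ η K ⟩
          K * δ * η                     ≤⟨ *-monoˡ-≤ 0≤Kδ (<⇒≤ η<aₖ) ⟩
          K * δ * a k                   ≈⟨ +-identityˡ _ ⟨
          0# + K * δ * a k              ≤⟨ +-monoˡ-≤ _ (0≤a k) ⟩
          a k + K * δ * a k             ≈⟨ solve 3 (λ K d a → a :+ K :* d :* a := (con (+ 1) :+ K :* d) :* a) refl K δ (a k) ⟩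
          (1# + K * δ) * a k            ∎)
    in k , (begin-strict
      a k      ≤⟨ aₖ≤η ⟩
      η        ≈⟨ +-identityʳ η ⟨
      η + 0#   <⟨ +-monoʳ-< η 0<η ⟩
      η + η    ≈⟨ η+η≈ε ⟩
      ε        ∎)

-- The probability of avoiding the boundary tends to 0.

module StoppedWalk {c ℓ₁ ℓ₂ : Level} {ℝ : RealNumbers c ℓ₁ ℓ₂} {n d : ℕ} (G : ConnectionGraph ℝ n d)
                   (0<deg : ∀ x → RealNumbers._<_ ℝ (RealNumbers.0# ℝ) (Voltage.deg G x)) (i j : Fin n) where
  open RealProperties ℝ
  open SumProperties ℝ
  open SequenceProperties ℝ
  open Matrices ℝ
  open MatrixProperties ℝ
  open ConnectionGraph G
  open RandomWalk G 0<deg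
  open WalkProperties G 0<deg
  open ≤-Reasoning

  Boundary : Fin n → Set
  Boundary x = x ≡ i ⊎ x ≡ j

  -- Abstract, so that does (boundary? x) is not unfolded and can be abstracted over by with.
  abstract
    boundary? : ∀ x → Dec (Boundary x)
    boundary? x = (x ≟ i) ⊎-dec (x ≟ j)

  -- survival m x is ℙˣ[T⁰ᵢ > m and T⁰ⱼ > m].
  survival : ℕ → Fin n → Carrier
  survival zero    x = if does (boundary? x) then 0# else 1#
  survival (suc m) x = if does (boundary? x) then 0# else average x (survival m)

  survival-boundary : ∀ m {x} → Boundary x → survival m x ≈ 0#
  survival-boundary zero {x} b with boundary? x
  ... | yes _ = refl
  ... | no ¬b = contradiction b ¬b
  survival-boundary (suc m) {x} b with boundary? x
  ... | yes _ = refl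
  ... | no ¬b = contradiction b ¬b

  survival-interior-zero : ∀ {x} → ¬ Boundary x → survival 0 x ≈ 1#
  survival-interior-zero {x} ¬b with boundary? x
  ... | yes b = contradiction b ¬b
  ... | no _  = refl

  survival-interior-suc : ∀ m {x} → ¬ Boundary x → survival (suc m) x ≈ average x (survival m)
  survival-interior-suc m {x} ¬b with boundary? x
  ... | yes b = contradiction b ¬b
  ... | no _  = refl

  survival-nonneg : ∀ m x → 0# ≤ survival m x
  survival-nonneg zero x with boundary? x
  ... | yes _ = ≤-refl
  ... | no _  = 0≤1
  survival-nonneg (suc m) x with boundary? x
  ... | yes _ = ≤-refl
  ... | no _  = sum-nonneg (λ y → *-nonneg (transition-nonneg x y) (survival-nonneg m y))

  -- The two bounds feed each other: the first decrease uses the bound by 1 at time 0, and later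
  -- bounds follow from the decrease.
  survival-dec : ∀ m x → survival (suc m) x ≤ survival m x
  survival-≤1 : ∀ m x → survival m x ≤ 1#

  survival-dec zero x with boundary? x
  ... | yes _ = ≤-refl
  ... | no _  = ≤-trans (average-mono x (λ y _ → survival-≤1 zero y)) (≤-reflexive (average-const x 1#))
  survival-dec (suc m) x with boundary? x
  ... | yes _ = ≤-refl
  ... | no _  = average-mono x (λ y _ → survival-dec m y)

  survival-≤1 zero x with boundary? x
  ... | yes _ = 0≤1
  ... | no _  = ≤-refl
  survival-≤1 (suc m) x = ≤-trans (survival-dec m x) (survival-≤1 m x)

  -- The slack `δ` at `z` enters the average with weight `transition x z`. Row `z` of the identity
  -- matrix serves as the indicator of `z`.
  average-gap : ∀ {x z f δ} → x ~ z → 0# ≤ δ → (∀ y → f y ≤ 1#) → f z + δ ≤ 1# →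
    average x f + transition x z * δ ≤ 1#
  average-gap {x} {z} {f} {δ} x~z 0≤δ f≤1 fz+δ≤1 = begin
    average x f + transition x z * δ              ≈⟨ +-congˡ (*-comm _ _) ⟩
    average x f + δ * transition x z              ≈⟨ +-congˡ (*-congˡ pick) ⟨
    average x f + δ * average x (Iz z)            ≈⟨ average-linear x f δ (Iz z) ⟨
    average x (λ y → f y + δ * Iz z y)            ≤⟨ average-mono x (λ y _ → pointwise y) ⟩
    average x (λ _ → 1#)                          ≈⟨ average-const x 1# ⟩
    1#                                            ∎
    where
    Iz : Matrix n
    Iz = Iᴹ
    pick : average x (Iz z) ≈ transition x z
    pick = trans (sum-cong-≋ (λ y → *-comm (transition x y) (Iz z y))) (sum-Iᴹ z (transition x))
    pointwise : ∀ y → f y + δ * Iz z y ≤ 1#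
    pointwise y with z ≟ y
    ... | yes ≡.refl = ≤-trans (≤-reflexive (+-congˡ (*-identityʳ δ))) fz+δ≤1
    ... | no _       = ≤-trans (≤-reflexive (trans (+-congˡ (zeroʳ δ)) (+-identityʳ (f y)))) (f≤1 y)

  boundary-gap : ∀ {x} → Boundary x → survival 0 x + 1# ≤ 1#
  boundary-gap b = ≤-reflexive (trans (+-congʳ (survival-boundary 0 b)) (+-identityˡ 1#))

  -- Induction along a path to `i`: on the boundary (possibly `j`, met earlier) the gap is 1 at time
  -- 0, and each interior step multiplies the gap by a positive transition probability.
  path-gap : ∀ {x} → Star _~_ x i → ∃[ N ] ∃[ δ ] 0# < δ × survival N x + δ ≤ 1#
  path-gap nil = 0 , 1# , 0<1 , boundary-gap (inj₁ ≡.refl)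
  path-gap {x} (_◅_ {j = z} x~z z⋆i) with boundary? x | path-gap z⋆i
  ... | yes b | _ = 0 , 1# , 0<1 , boundary-gap b
  ... | no ¬b | N , δ , 0<δ , gap =
    suc N , transition x z * δ , *-pos (transition-pos x~z) 0<δ ,
    ≤-trans (+-monoˡ-≤ _ (≤-reflexive (survival-interior-suc N ¬b)))
            (average-gap x~z (<⇒≤ 0<δ) (survival-≤1 N) gap)

  vertex-gap : ∀ x → ∃[ N ] ∃[ δ ] 0# < δ × δ ≤ 1# × survival N x + δ ≤ 1#
  vertex-gap x =
    let N , δ , 0<δ , gap = path-gap (connected x i)
    in N , δ , 0<δ , (begin
      δ                    ≈⟨ +-identityˡ δ ⟨
      0# + δ               ≤⟨ +-monoˡ-≤ δ (survival-nonneg N x) ⟩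
      survival N x + δ     ≤⟨ gap ⟩
      1#                   ∎) , gap

  -- The uniform gap is the case of time 0 in the interior. Averaging is linear and monotone, so it
  -- carries the inequality to all later times.
  survival-contraction : ∃[ N ] ∃[ δ ] 0# < δ ×
    (∀ m x → survival (m ℕ.+ N) x + δ * survival m x ≤ survival m x)
  survival-contraction =
    let N , δ , 0<δ , _ , gap = uniform-gap (λ x m → survival m x) (λ x m → survival-dec m x) vertex-gap
    in N , δ , 0<δ , contract N δ gap
    where
    module _ (N : ℕ) (δ : Carrier) (gap : ∀ x → survival N x + δ ≤ 1#) where
      at-boundary : ∀ k m {x} → Boundary x → survival k x + δ * survival m x ≤ survival m x
      at-boundary k m {x} b = ≤-reflexive (begin-equality
        survival k x + δ * survival m x   ≈⟨ +-cong (survival-boundary k b) (*-congˡ (survival-boundary m b)) ⟩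
        0# + δ * 0#                       ≈⟨ solve 1 (λ d → con (+ 0) :+ d :* con (+ 0) := con (+ 0)) refl δ ⟩
        0#                                ≈⟨ survival-boundary m b ⟨
        survival m x                      ∎)

      contract : ∀ m x → survival (m ℕ.+ N) x + δ * survival m x ≤ survival m x
      contract m x with boundary? x
      contract m x       | yes b = at-boundary (m ℕ.+ N) m b
      contract zero x    | no ¬b = begin
        survival N x + δ * survival 0 x   ≈⟨ +-congˡ (trans (*-congˡ (survival-interior-zero ¬b)) (*-identityʳ δ)) ⟩
        survival N x + δ                  ≤⟨ gap x ⟩
        1#                                ≈⟨ survival-interior-zero ¬b ⟨
        survival 0 x                      ∎
      contract (suc m) x | no ¬b = begin
        survival (suc (m ℕ.+ N)) x + δ * survival (suc m) x
          ≈⟨ +-cong (survival-interior-suc (m ℕ.+ N) ¬b) (*-congˡ (survival-interior-suc m ¬b)) ⟩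
        average x (survival (m ℕ.+ N)) + δ * average x (survival m)
          ≈⟨ average-linear x (survival (m ℕ.+ N)) δ (survival m) ⟨
        average x (λ y → survival (m ℕ.+ N) y + δ * survival m y)
          ≤⟨ average-mono x (λ y _ → contract m y) ⟩
        average x (survival m)
          ≈⟨ survival-interior-suc m ¬b ⟨
        survival (suc m) x
          ∎

  survival-vanishes : ∀ x ε → 0# < ε → ∃[ N ] ∀ m → N ℕ.≤ m → survival m x < ε
  survival-vanishes x ε 0<ε =
    let N , δ , 0<δ , contract = survival-contraction
        k , small = contraction-vanishes 0<δ (λ k → survival-nonneg (k ℕ.* N) x) (survival-≤1 0 x)
          -- The contraction is iterated along the multiples of `N`. As `suc k ℕ.* N` unfolds to
          -- `N ℕ.+ k ℕ.* N`, the sum is commuted to fit.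
          (λ k → ≡.subst (λ m → survival m x + δ * survival (k ℕ.* N) x ≤ survival (k ℕ.* N) x)
                         (ℕ.+-comm (k ℕ.* N) N) (contract (k ℕ.* N) x))
          ε 0<ε
    in k ℕ.* N , λ m kN≤m → ≤-<-trans (antitone-≤ (λ l → survival-dec l x) kN≤m) small

-- Functions of the path stopped at the boundary, and their expectations.

module HittingExpectations {c ℓ₁ ℓ₂ : Level} {ℝ : RealNumbers c ℓ₁ ℓ₂} {n d : ℕ} (G : ConnectionGraph ℝ n d)
                           (0<deg : ∀ x → RealNumbers._<_ ℝ (RealNumbers.0# ℝ) (Voltage.deg G x))
                           (i j : Fin n) (i≢j : i ≢ j) where
  open RealProperties ℝ
  open SumProperties ℝ
  open Matrices ℝ
  open MatrixProperties ℝ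
  open ConnectionGraph G
  open Voltage G using (deg; IsConnectionVoltage; module IsConnectionVoltage)
  open RandomWalk G 0<deg
  open WalkProperties G 0<deg
  open StoppedWalk G 0<deg i j
  open ≤-Reasoning

  -- An entry of `σ x y *ᴹ M` is such a combination of entries of `M`, so this takes expectations
  -- through the transport.
  finiteExpectation-sum : ∀ m x {k} (q : Fin k → Carrier) (F : Fin k → Vec (Fin n) (suc m) → Carrier) →
    finiteExpectation m x (λ v → sum (λ l → q l * F l v)) ≈ sum (λ l → q l * finiteExpectation m x (F l))
  finiteExpectation-sum m x {zero}  q F = finiteExpectation-const m x 0#
  finiteExpectation-sum m x {suc k} q F = begin-equality
    finiteExpectation m x (λ v → q zero * F zero v + rest v)
      ≈⟨ finiteExpectation-cong m x (λ v → q zero * F zero v + rest v) (λ v → rest v + q zero * F zero v) (λ v → +-comm _ _) ⟩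
    finiteExpectation m x (λ v → rest v + q zero * F zero v)
      ≈⟨ finiteExpectation-linear m x rest (q zero) (F zero) ⟩
    finiteExpectation m x rest + q zero * finiteExpectation m x (F zero)
      ≈⟨ +-comm _ _ ⟩
    q zero * finiteExpectation m x (F zero) + finiteExpectation m x rest
      ≈⟨ +-congˡ (finiteExpectation-sum m x (q ∘ suc) (F ∘ suc)) ⟩
    sum (λ l → q l * finiteExpectation m x (F l))
      ∎
    where
    rest : Vec (Fin n) (suc m) → Carrier
    rest v = sum (λ l → q (suc l) * F (suc l) v)

  module _ {b} {B : Set b} (f : Fin n → B) (act : Fin n → Fin n → B → B) where

    -- The value of f at the boundary vertex reached first, or else at the last vertex, transported back along the path.
    stopped : ∀ {m} → Vec (Fin n) (suc m) → B
    stopped (x ∷ [])    = f x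
    stopped (x ∷ y ∷ v) = if does (boundary? x) then f x else act x y (stopped (y ∷ v))

    stopped-boundary : ∀ {m x} → Boundary x → (v : Vec (Fin n) m) → stopped (x ∷ v) ≡ f x
    stopped-boundary b [] = ≡.refl
    stopped-boundary {x = x} b (y ∷ v) with boundary? x
    ... | yes _ = ≡.refl
    ... | no ¬b = contradiction b ¬b

    stopped-interior : ∀ {m x y} → ¬ Boundary x → (v : Vec (Fin n) m) →
      stopped (x ∷ y ∷ v) ≡ act x y (stopped (y ∷ v))
    stopped-interior {x = x} ¬b v with boundary? x
    ... | yes b = contradiction b ¬b
    ... | no _  = ≡.refl

    -- `φ` reads a real number off `B`: the identity for scalars, an entry for matrices.
    expectation-stopped-boundary : ∀ (φ : B → Carrier) m {x} → Boundary x →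
      finiteExpectation m x (φ ∘ stopped) ≈ φ (f x)
    expectation-stopped-boundary φ m {x} b = trans
      (finiteExpectation-cong m x (φ ∘ stopped) (λ _ → φ (f x)) (λ v → reflexive (≡.cong φ (stopped-boundary b v))))
      (finiteExpectation-const m x (φ (f x)))

    expectation-stopped-interior : ∀ (φ : B → Carrier) m {x} → ¬ Boundary x →
      finiteExpectation (suc m) x (φ ∘ stopped) ≈ average x (λ y → finiteExpectation m y (φ ∘ act x y ∘ stopped))
    expectation-stopped-interior φ m {x} ¬b = trans
      (finiteExpectation-suc m x (φ ∘ stopped))
      (average-cong x (λ y → finiteExpectation-cong m y (φ ∘ stopped ∘ (x ∷_)) (φ ∘ act x y ∘ stopped)
        (λ v → reflexive (≡.cong φ (stopped-interior ¬b v)))))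

  -- The indicator that none of the listed vertices is in the boundary: `survival 0` is the
  -- indicator of the interior, carried back unchanged.
  undecided : ∀ {m} → Vec (Fin n) (suc m) → Carrier
  undecided = stopped (survival 0) (λ _ _ r → r)

  expectation-undecided : ∀ m x → finiteExpectation m x undecided ≈ survival m x
  expectation-undecided m x with boundary? x
  expectation-undecided m x       | yes b = trans
    (expectation-stopped-boundary (survival 0) (λ _ _ r → r) (λ r → r) m b)
    (trans (survival-boundary 0 b) (sym (survival-boundary m b)))
  expectation-undecided zero x    | no ¬b = finiteExpectation-zero x undecided
  expectation-undecided (suc m) x | no ¬b = begin-equality
    finiteExpectation (suc m) x undecided
      ≈⟨ expectation-stopped-interior (survival 0) (λ _ _ r → r) (λ r → r) m ¬b ⟩
    average x (λ y → finiteExpectation m y undecided)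
      ≈⟨ average-cong x (expectation-undecided m) ⟩
    average x (survival m)
      ≈⟨ survival-interior-suc m ¬b ⟨
    survival (suc m) x
      ∎

  module _ {b p q} {B : Set b} (f : Fin n → B) (act : Fin n → Fin n → B → B)
           (Decided : Trajectory → B → Set p) (Open : B → Set q)
           (decided-start : ∀ X → Boundary (X 0) → Decided X (f (X 0)))
           (decided-step  : ∀ X {r} → X 0 ~ X 1 → ¬ Boundary (X 0) → Decided (X ∘ suc) r → Decided X (act (X 0) (X 1) r))
           (open-start    : ∀ x → Open (f x))
           (open-step     : ∀ {x y r} → x ~ y → Open r → Open (act x y r))
           where

    -- Induction along the walk. If the boundary is met within `m` steps, `Decided` is carried back
    -- by `act` from the first boundary vertex; otherwise `Open` is carried back from the last
    -- vertex.
    stopped-cases : ∀ m X → IsWalk X →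
      (undecided (prefix m X) ≈ 0# × Decided X (stopped f act (prefix m X)))
      ⊎ (undecided (prefix m X) ≈ 1# × Open (stopped f act (prefix m X)))
    stopped-cases m X walk with boundary? (X 0)
    stopped-cases zero X walk    | yes b = inj₁ (survival-boundary 0 b , decided-start X b)
    stopped-cases (suc m) X walk | yes b
      rewrite stopped-boundary (survival 0) (λ _ _ r → r) b (prefix m (X ∘ suc))
            | stopped-boundary f act b (prefix m (X ∘ suc))
      = inj₁ (survival-boundary 0 b , decided-start X b)
    stopped-cases zero X walk    | no ¬b = inj₂ (survival-interior-zero ¬b , open-start (X 0))
    stopped-cases (suc m) X walk | no ¬b
      rewrite stopped-interior (survival 0) (λ _ _ r → r) {y = X 1} ¬b (tail (prefix m (X ∘ suc)))
            | stopped-interior f act {y = X 1} ¬b (tail (prefix m (X ∘ suc)))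
      with stopped-cases m (X ∘ suc) (walk ∘ suc)
    ... | inj₁ (≈0 , decided) = inj₁ (≈0 , decided-step X (walk 0) ¬b decided)
    ... | inj₂ (≈1 , open′)   = inj₂ (≈1 , open-step (walk 0) open′)

  -- Expectations from brackets whose width is a multiple of `undecided`.

  module _ {x : Fin n} {A : Event} {Z : VariableOn A} {K : Carrier} (0<K : 0# < K)
           (Φ : ∀ {m} → Vec (Fin n) (suc m) → Carrier)
           (brackets : ∀ m → Brackets x A Z {m} (λ v → Φ v + - K * undecided v) (λ v → Φ v + K * undecided v))
           where

    private
      L U : ∀ {m} → Vec (Fin n) (suc m) → Carrier
      L v = Φ v + - K * undecided v
      U v = Φ v + K * undecided v

      s : ℕ → Carrier
      s m = finiteExpectation m x Φ

      lower : ∀ m → finiteExpectation m x L ≈ s m - K * survival m x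
      lower m = begin-equality
        finiteExpectation m x L     ≈⟨ finiteExpectation-linear m x Φ (- K) undecided ⟩
        s m + - K * finiteExpectation m x undecided               ≈⟨ +-congˡ (*-congˡ (expectation-undecided m x)) ⟩
        s m + - K * survival m x                                  ≈⟨ +-congˡ (-‿distribˡ-* K (survival m x)) ⟨
        s m - K * survival m x                                    ∎

      upper : ∀ m → finiteExpectation m x U ≈ s m + K * survival m x
      upper m = trans (finiteExpectation-linear m x Φ K undecided) (+-congˡ (*-congˡ (expectation-undecided m x)))

      error-vanishes : ∀ ε → 0# < ε → ∃[ N ] ∀ m → N ℕ.≤ m → K * survival m x < ε
      error-vanishes ε 0<ε =
        -- Survival is asked to fall below `ε / K`.
        let N , small = survival-vanishes x (inverse K 0<K * ε) (*-pos (inverse-pos 0<K) 0<ε)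
        in N , λ m N≤m → begin-strict
             K * survival m x          <⟨ *-monoˡ-< 0<K (small m N≤m) ⟩
             K * (inverse K 0<K * ε)   ≈⟨ *-assoc _ _ _ ⟨
             K * inverse K 0<K * ε     ≈⟨ *-congʳ (inverse-*ʳ 0<K) ⟩
             1# * ε                    ≈⟨ *-identityˡ ε ⟩
             ε                         ∎

    -- A lower expectation lies below an upper one for any two numbers of steps, so `s k` and `s l`
    -- differ by at most the sum of their error terms.
    brackets⇒Cauchy : Cauchy s
    brackets⇒Cauchy ε 0<ε =
      let δ , 0<δ , δ+δ≈ε = half 0<ε
          N , small = error-vanishes δ 0<δ
      in N , λ k l N≤k N≤l → begin-strict
           s k - s l
             ≈⟨ solve 3 (λ u v r → u :- v := (u :- r) :+ (r :- v)) refl (s k) (s l) (K * survival k x) ⟩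
           (s k - K * survival k x) + (K * survival k x - s l)
             ≤⟨ +-monoˡ-≤ _ (between k l) ⟩
           (s l + K * survival l x) + (K * survival k x - s l)
             ≈⟨ solve 3 (λ v r r′ → (v :+ r) :+ (r′ :- v) := r :+ r′) refl (s l) (K * survival l x) (K * survival k x) ⟩
           K * survival l x + K * survival k x
             <⟨ +-mono-< (small l N≤l) (small k N≤k) ⟩
           δ + δ
             ≈⟨ δ+δ≈ε ⟩
           ε
             ∎
      where
      between : ∀ k l → s k - K * survival k x ≤ s l + K * survival l x
      between k l = begin
        s k - K * survival k x                                    ≈⟨ lower k ⟨
        finiteExpectation k x L     ≤⟨ brackets-≤ {x} {A} {Z} {L = L} {U} {L} {U} (brackets k) (brackets l) ⟩
        finiteExpectation l x U       ≈⟨ upper l ⟩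
        s l + K * survival l x                                    ∎

    brackets⇒expectation : ∀ {e} → s ⟶ e → IsExpectation x A Z e
    brackets⇒expectation {e} s⟶e ε 0<ε =
      let δ , 0<δ , δ+δ≈ε = half 0<ε
          N , small = error-vanishes δ 0<δ
          M , close = s⟶e δ 0<δ
          -- Past `N` the error term is below `δ`, past `M` the distance to the limit is; together
          -- they use up `ε`.
          m = N ℕ.+ M
          sm-e<δ , e-sm<δ = close m (ℕ.m≤n+m M N)
          Kr<δ = small m (ℕ.m≤m+n N M)
      in m , L , U , brackets m ,
         (0<y-x⇒x<y (begin-strict
           0#
             <⟨ x<y⇒0<y-x (+-mono-< e-sm<δ Kr<δ) ⟩
           (δ + δ) - ((e - s m) + K * survival m x)
             ≈⟨ +-congʳ δ+δ≈ε ⟩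
           ε - ((e - s m) + K * survival m x)
             ≈⟨ solve 4 (λ ε e s r → ε :- ((e :- s) :+ r) := (s :- r) :- (e :- ε)) refl ε e (s m) (K * survival m x) ⟩
           (s m - K * survival m x) - (e - ε)
             ≈⟨ +-congʳ (lower m) ⟨
           finiteExpectation m x L - (e - ε)
             ∎)) ,
         (begin-strict
           finiteExpectation m x U
             ≈⟨ upper m ⟩
           s m + K * survival m x
             ≈⟨ solve 3 (λ e s r → s :+ r := e :+ ((s :- e) :+ r)) refl e (s m) (K * survival m x) ⟩
           e + ((s m - e) + K * survival m x)
             <⟨ +-monoʳ-< e (+-mono-< sm-e<δ Kr<δ) ⟩
           e + (δ + δ)
             ≈⟨ +-congˡ δ+δ≈ε ⟩
           e + ε
             ∎)

  -- Shifting the event and the signature by one step.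

  private
    A : Event
    A = T⁰[ i ]<T⁰[ j ]

  start-i : ∀ {X} → X 0 ≡ i → A X
  -- `HitsAfter` also excludes `j` at time 0 itself, which is where `i≢j` enters.
  start-i X₀≡i = 0 , (X₀≡i , λ _ ()) , λ { .0 z≤n X₀≡j → i≢j (≡.trans (≡.sym X₀≡i) X₀≡j) }

  start-j : ∀ {X} → X 0 ≡ j → ¬ A X
  start-j X₀≡j (t , _ , after) = after 0 z≤n X₀≡j

  -- An interior start keeps the first hit of `i` first and adds no visit to `j`.
  shift : ∀ {X} → ¬ Boundary (X 0) → A (X ∘ suc) → A X
  shift ¬b (t , (hit , before) , after) =
    suc t ,
    (hit , λ { zero _ X₀≡i → ¬b (inj₁ X₀≡i) ; (suc s) (s≤s s<t) → before s s<t }) ,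
    λ { zero _ X₀≡j → ¬b (inj₂ X₀≡j) ; (suc s) (s≤s s≤t) → after s s≤t }

  unshift : ∀ {X} t → HitsAt i X (suc t) × HitsAfter j X (suc t) → HitsAt i (X ∘ suc) t × HitsAfter j (X ∘ suc) t
  unshift t ((hit , before) , after) =
    (hit , λ s s<t → before (suc s) (s≤s s<t)) , λ s s≤t → after (suc s) (s≤s s≤t)

  -- `signature` grows on the right while `stopped` peels the path from the left; associativity
  -- reconciles the two recursions.
  signature-suc : ∀ X t → signature X (suc t) ≈ᴹ σ (X 0) (X 1) *ᴹ signature (X ∘ suc) t
  signature-suc X zero = ≈ᴹ-trans (*ᴹ-identityˡ (σ (X 0) (X 1))) (≈ᴹ-sym (*ᴹ-identityʳ (σ (X 0) (X 1))))
  signature-suc X (suc t) = ≈ᴹ-trans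
    (*ᴹ-congʳ (σ (X (suc t)) (X (suc (suc t)))) (signature-suc X t))
    (*ᴹ-assoc (σ (X 0) (X 1)) (signature (X ∘ suc) t) (σ (X (suc t)) (X (suc (suc t)))))

  -- With the first step peeled off, an orthogonal factor stands on the left, where it preserves
  -- column norms.
  columnNormSq-signature : ∀ {X} → IsWalk X → ∀ t b → columnNormSq b (signature X t) ≈ 1#
  columnNormSq-signature walk zero b = columnNormSq-Iᴹ b
  columnNormSq-signature {X} walk (suc t) b = begin-equality
    columnNormSq b (signature X (suc t))                          ≈⟨ columnNormSq-cong b (signature-suc X t) ⟩
    columnNormSq b (σ (X 0) (X 1) *ᴹ signature (X ∘ suc) t)       ≈⟨ columnNormSq-orthogonal (σ-orth (walk 0)) b (signature (X ∘ suc) t) ⟩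
    columnNormSq b (signature (X ∘ suc) t)                        ≈⟨ columnNormSq-signature (walk ∘ suc) t b ⟩
    1#                                                            ∎

  Bounded : Carrier → Carrier → Set ℓ₂
  Bounded b x = (- b ≤ x) × (x ≤ b)

  exact-bracket : ∀ {φ r z} K → r ≈ 0# → φ ≈ z → (φ + - K * r ≤ z) × (z ≤ φ + K * r)
  exact-bracket {φ} {r} {z} K r≈0 φ≈z = ≤-reflexive (absorb (- K)) , ≤-reflexive (sym (absorb K))
    where
    absorb : ∀ k → φ + k * r ≈ z
    absorb k = trans (+-congˡ (trans (*-congˡ r≈0) (zeroʳ k))) (trans (+-identityʳ φ) φ≈z)

  -- Two numbers in `[-b, b]` differ by at most `b + b`, hence this constant.
  wide-bracket : ∀ {b φ r z} → r ≈ 1# → Bounded b φ → Bounded b z →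
    (φ + - (b + b) * r ≤ z) × (z ≤ φ + (b + b) * r)
  wide-bracket {b} {φ} {r} {z} r≈1 (-b≤φ , φ≤b) (-b≤z , z≤b) = (begin
      φ + - (b + b) * r   ≈⟨ +-congˡ (trans (*-congˡ r≈1) (*-identityʳ _)) ⟩
      φ - (b + b)         ≤⟨ +-monoˡ-≤ _ φ≤b ⟩
      b - (b + b)         ≈⟨ solve 1 (λ b → b :- (b :+ b) := :- b) refl b ⟩
      - b                 ≤⟨ -b≤z ⟩
      z                   ∎) , (begin
      z                   ≤⟨ z≤b ⟩
      b                   ≈⟨ solve 1 (λ b → b := :- b :+ (b :+ b)) refl b ⟩
      - b + (b + b)       ≤⟨ +-monoˡ-≤ _ -b≤φ ⟩
      φ + (b + b)         ≈⟨ +-congˡ (trans (*-congˡ r≈1) (*-identityʳ _)) ⟨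
      φ + (b + b) * r     ∎)

  bounded-zero : ∀ {b} → 0# ≤ b → Bounded b 0#
  bounded-zero 0≤b = ≤-trans (neg-mono-≤ 0≤b) (≤-reflexive -0#≈0#) , 0≤b

  bounded-square : ∀ {b x} → 0# ≤ b → x * x ≤ b * b → Bounded b x
  bounded-square 0≤b x²≤b² = square≤⇒-≤ 0≤b x²≤b² , square≤⇒≤ 0≤b x²≤b²

  signature-bounded : ∀ {X} → IsWalk X → ∀ t a b → Bounded 1# (signature X t a b)
  signature-bounded {X} walk t a b = bounded-square 0≤1 (begin
    signature X t a b * signature X t a b   ≤⟨ square≤columnNormSq (signature X t) a b ⟩
    columnNormSq b (signature X t)          ≈⟨ columnNormSq-signature walk t b ⟩
    1#                                      ≈⟨ *-identityˡ 1# ⟨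
    1# * 1#                                 ∎)

  bounded-weaken : ∀ {b b′ x} → b ≤ b′ → Bounded b x → Bounded b′ x
  bounded-weaken b≤b′ (-b≤x , x≤b) = ≤-trans (neg-mono-≤ b≤b′) -b≤x , ≤-trans x≤b b≤b′

  -- Decided walks have error term 0 and the exact value; on undecided ones `Φ`, `Z` and the value 0
  -- off `A` all lie in `[-b, b]`.
  cases⇒brackets : ∀ {x Z b} m (Φ : Vec (Fin n) (suc m) → Carrier) → 0# ≤ b →
    (∀ X → IsWalk X → ∀ a → Bounded b (Z X a)) →
    (∀ X → IsWalk X →
      (undecided (prefix m X) ≈ 0# × (∀ a → Φ (prefix m X) ≈ Z X a) × (¬ A X → Φ (prefix m X) ≈ 0#))
      ⊎ (undecided (prefix m X) ≈ 1# × Bounded b (Φ (prefix m X)))) →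
    Brackets x A Z {m} (λ v → Φ v + - (b + b) * undecided v) (λ v → Φ v + (b + b) * undecided v)
  cases⇒brackets {b = b} m Φ 0≤b boundedZ cases X (_ , walk) with cases X walk
  ... | inj₁ (r≈0 , Φ≈Z , Φ≈0) =
    (λ a → exact-bracket (b + b) r≈0 (Φ≈Z a)) , (λ ¬a → exact-bracket (b + b) r≈0 (Φ≈0 ¬a))
  ... | inj₂ (r≈1 , boundedΦ) =
    (λ a → wide-bracket r≈1 boundedΦ (boundedZ X walk a)) , (λ _ → wide-bracket r≈1 boundedΦ (bounded-zero 0≤b))

  -- The hitting probability.

  hit : Fin n → Carrier
  hit x = if does (x ≟ i) then 1# else 0#

  hit-i : ∀ {x} → x ≡ i → hit x ≈ 1#
  hit-i {x} x≡i with x ≟ i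
  ... | yes _  = refl
  ... | no x≢i = contradiction x≡i x≢i

  hit-other : ∀ {x} → x ≢ i → hit x ≈ 0#
  hit-other {x} x≢i with x ≟ i
  ... | yes x≡i = contradiction x≡i x≢i
  ... | no _    = refl

  bounded-one : Bounded 1# 1#
  bounded-one = ≤-trans (proj₁ (bounded-zero 0≤1)) 0≤1 , ≤-refl

  hit-bounded : ∀ x → Bounded 1# (hit x)
  hit-bounded x with x ≟ i
  ... | yes _ = bounded-one
  ... | no _  = bounded-zero 0≤1

  -- The indicator that `i` is reached before `j` within the given steps; an undecided path ends in
  -- the interior and gets 0.
  hitFirst : ∀ {m} → Vec (Fin n) (suc m) → Carrier
  hitFirst = stopped hit (λ _ _ r → r)

  hitFirst-brackets : ∀ {x} m → Brackets x A (λ _ _ → 1#) {m}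
    (λ v → hitFirst v + - (1# + 1#) * undecided v) (λ v → hitFirst v + (1# + 1#) * undecided v)
  hitFirst-brackets m = cases⇒brackets m hitFirst 0≤1 (λ _ _ _ → bounded-one)
    (stopped-cases hit (λ _ _ r → r) Decided (Bounded 1#) at-start at-step hit-bounded (λ _ bounded → bounded) m)
    where
    Decided : Trajectory → Carrier → Set ℓ₁
    Decided X r = (A X → r ≈ 1#) × (¬ A X → r ≈ 0#)

    at-start : ∀ X → Boundary (X 0) → Decided X (hit (X 0))
    at-start X (inj₁ X₀≡i) = (λ _ → hit-i X₀≡i) , (λ ¬a → contradiction (start-i X₀≡i) ¬a)
    at-start X (inj₂ X₀≡j) = (λ a → contradiction a (start-j X₀≡j)) ,
      (λ _ → hit-other (λ X₀≡i → i≢j (≡.trans (≡.sym X₀≡i) X₀≡j)))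

    at-step : ∀ X {r} → X 0 ~ X 1 → ¬ Boundary (X 0) → Decided (X ∘ suc) r → Decided X r
    at-step X _ ¬b (on , off) =
      -- From an interior vertex a hit at time 0 is impossible, and a later one is a hit of the
      -- shifted walk.
      (λ { (zero , (X₀≡i , _) , _) → contradiction (inj₁ X₀≡i) ¬b ; (suc t , a) → on (t , unshift t a) }) ,
      (λ ¬a → off (¬a ∘ shift ¬b))

  -- The probability is obtained as a limit: the brackets make the finite-time values Cauchy, and
  -- completeness supplies the number.
  hittingProbability : ∀ x → ∃[ p ] IsProbability x A p
  hittingProbability x =
    let p , s⟶p = complete (λ m → finiteExpectation m x hitFirst)
                           (brackets⇒Cauchy {Z = λ _ _ → 1#} (+-pos 0<1 0<1) hitFirst hitFirst-brackets)
    in p , brackets⇒expectation (+-pos 0<1 0<1) hitFirst hitFirst-brackets s⟶p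

  -- If |Z| ≤ 1 on A, then bounds on the indicator of A bound Z · 1_A as well.
  nonpositiveProbability⇒zeroExpectation : ∀ {x p Z} → IsProbability x A p → p ≤ 0# →
    (∀ X → IsWalk X → ∀ h → Bounded 1# (Z X h)) → IsExpectation x A Z 0#
  nonpositiveProbability⇒zeroExpectation {x} {p} P p≤0 boundedZ ε 0<ε =
      let m , _ , U , LZU , _ , U<p+ε = P ε 0<ε
          U<ε : finiteExpectation m x U < ε
          U<ε = begin-strict
            finiteExpectation m x U   <⟨ U<p+ε ⟩
            p + ε                     ≤⟨ +-monoˡ-≤ ε p≤0 ⟩
            0# + ε                    ≈⟨ +-identityˡ ε ⟩
            ε                         ∎
          -- The lower function is `- U`, written as a combination to which linearity applies.
          negU : finiteExpectation m x (λ v → 0# + - 1# * U v) ≈ - finiteExpectation m x U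
          negU = begin-equality
            finiteExpectation m x (λ v → 0# + - 1# * U v)
              ≈⟨ finiteExpectation-linear m x (λ _ → 0#) (- 1#) U ⟩
            finiteExpectation m x (λ _ → 0#) + - 1# * finiteExpectation m x U
              ≈⟨ +-congʳ (finiteExpectation-const m x 0#) ⟩
            0# + - 1# * finiteExpectation m x U
              ≈⟨ neg (finiteExpectation m x U) ⟩
            - finiteExpectation m x U
              ∎
      in m , (λ v → 0# + - 1# * U v) , U ,
         (λ X walk →
           (λ h → let 1≤U = proj₂ (proj₁ (LZU X walk) h)
                      -1≤Z , Z≤1 = boundedZ X (proj₂ walk) h
                  in ≤-trans (≤-reflexive (neg _)) (≤-trans (neg-mono-≤ 1≤U) -1≤Z) , ≤-trans Z≤1 1≤U) ,
           (λ ¬h → let 0≤U = proj₂ (proj₂ (LZU X walk) ¬h)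
                   in ≤-trans (≤-reflexive (neg _)) (proj₁ (bounded-zero 0≤U)) , 0≤U)) ,
         (begin-strict
           0# - ε                                              ≈⟨ +-identityˡ (- ε) ⟩
           - ε                                                 <⟨ neg-mono-< U<ε ⟩
           - finiteExpectation m x U                           ≈⟨ negU ⟨
           finiteExpectation m x (λ v → 0# + - 1# * U v)       ∎) ,
         <-respʳ-≈ (sym (+-identityˡ ε)) U<ε
      where
      neg : ∀ u → 0# + - 1# * u ≈ - u
      neg u = solve 1 (λ u → con (+ 0) :+ :- con (+ 1) :* u := :- u) refl u

  -- The voltage as the expected signature on the event.

  module _ (𝒱 : Fin n → Matrix d) (voltage : IsConnectionVoltage i j 𝒱) where
    open IsConnectionVoltage voltage

    transport : Fin n → Fin n → Matrix d → Matrix d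
    transport x y M = σ x y *ᴹ M

    -- The difference of the two sides is the Laplacian at `x` divided by the degree, and
    -- harmonicity makes it 0.
    average-transport : ∀ {x} → ¬ Boundary x → ∀ a b → average x (λ y → transport x y (𝒱 y) a b) ≈ 𝒱 x a b
    average-transport {x} ¬b a b = begin-equality
      average x g
        ≈⟨ +-identityʳ _ ⟨
      average x g + 0#
        ≈⟨ +-congˡ (zeroʳ 1#) ⟨
      average x g + 1# * 0#
        ≈⟨ +-congˡ (*-congˡ defect) ⟨
      average x g + 1# * average x (λ y → 𝒱 x a b - g y)
        ≈⟨ average-linear x g 1# (λ y → 𝒱 x a b - g y) ⟨
      average x (λ y → g y + 1# * (𝒱 x a b - g y))
        ≈⟨ average-cong x (λ y → solve 2 (λ g v → g :+ con (+ 1) :* (v :- g) := v) refl (g y) (𝒱 x a b)) ⟩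
      average x (λ _ → 𝒱 x a b)
        ≈⟨ average-const x (𝒱 x a b) ⟩
      𝒱 x a b
        ∎
      where
      inv = inverse (deg x) (0<deg x)

      g : Fin n → Carrier
      g y = transport x y (𝒱 y) a b

      defect : average x (λ y → 𝒱 x a b - g y) ≈ 0#
      defect = begin-equality
        average x (λ y → 𝒱 x a b - g y)
          ≈⟨ sum-cong-≋ (λ y → solve 3 (λ w r u → w :* r :* u := r :* (w :* u)) refl (w x y) inv (𝒱 x a b - g y)) ⟩
        sum (λ y → inv * (w x y * (𝒱 x a b - g y)))
          ≈⟨ *-distribˡ-sum inv (λ y → w x y * (𝒱 x a b - g y)) ⟨
        inv * sum (λ y → w x y * (𝒱 x a b - g y))
          ≈⟨ *-congˡ (harmonic x (¬b ∘ inj₁) (¬b ∘ inj₂) a b) ⟩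
        inv * 0#
          ≈⟨ zeroʳ inv ⟩
        0#
          ∎

    stoppedVoltage : ∀ {m} → Vec (Fin n) (suc m) → Matrix d
    stoppedVoltage = stopped 𝒱 transport

    -- Optional stopping: the transported voltage is a martingale until the boundary is reached.
    expectation-stoppedVoltage : ∀ m x a b → finiteExpectation m x (λ v → stoppedVoltage v a b) ≈ 𝒱 x a b
    expectation-stoppedVoltage m x a b with boundary? x
    expectation-stoppedVoltage m x a b       | yes bd = expectation-stopped-boundary 𝒱 transport (λ M → M a b) m bd
    expectation-stoppedVoltage zero x a b    | no ¬bd = finiteExpectation-zero x (λ v → stoppedVoltage v a b)
    expectation-stoppedVoltage (suc m) x a b | no ¬bd = begin-equality
      finiteExpectation (suc m) x (λ v → stoppedVoltage v a b)
        ≈⟨ expectation-stopped-interior 𝒱 transport (λ M → M a b) m ¬bd ⟩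
      average x (λ y → finiteExpectation m y (λ v → transport x y (stoppedVoltage v) a b))
        -- Transport mixes the entries of column `b`, so the induction hypothesis is taken at every
        -- row `k`.
        ≈⟨ average-cong x (λ y → trans
             (finiteExpectation-sum m y (σ x y a) (λ k v → stoppedVoltage v k b))
             (sum-cong-≋ (λ k → *-congˡ (expectation-stoppedVoltage m y k b)))) ⟩
      average x (λ y → transport x y (𝒱 y) a b)
        ≈⟨ average-transport ¬bd a b ⟩
      𝒱 x a b
        ∎

    -- A sum in place of a maximum: one number dominating all column norms of the voltage at all
    -- vertices.
    totalNormSq : Carrier
    totalNormSq = sum (λ y → sum (λ b → columnNormSq b (𝒱 y)))

    columnNormSq-nonneg : ∀ b (M : Matrix d) → 0# ≤ columnNormSq b M
    columnNormSq-nonneg b M = sum-nonneg (λ a → square-nonneg (M a b))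

    columnNormSq≤total : ∀ y b → columnNormSq b (𝒱 y) ≤ totalNormSq
    columnNormSq≤total y b = ≤-trans
      (term≤sum (λ b′ → columnNormSq-nonneg b′ (𝒱 y)) b)
      (term≤sum (λ y′ → sum-nonneg (λ b′ → columnNormSq-nonneg b′ (𝒱 y′))) y)

    totalNormSq-nonneg : 0# ≤ totalNormSq
    totalNormSq-nonneg = sum-nonneg (λ y → sum-nonneg (λ b → columnNormSq-nonneg b (𝒱 y)))

    -- The added 1 makes it positive, covers the bound 1 on signatures, and keeps it below its own
    -- square, so entries are bounded without square roots.
    bound : Carrier
    bound = 1# + totalNormSq

    1≤bound : 1# ≤ bound
    1≤bound = ≤-trans (≤-reflexive (sym (+-identityʳ 1#))) (+-monoʳ-≤ 1# totalNormSq-nonneg)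

    0<bound : 0# < bound
    0<bound = <-≤-trans 0<1 1≤bound

    bound≤bound² : bound ≤ bound * bound
    bound≤bound² = ≤-trans (≤-reflexive (sym (*-identityˡ bound))) (*-monoʳ-≤ (<⇒≤ 0<bound) 1≤bound)

    stoppedVoltage-brackets : ∀ {x} a b m → Brackets x A (λ X h → signatureAtHit i j X h a b) {m}
      (λ v → stoppedVoltage v a b + - (bound + bound) * undecided v)
      (λ v → stoppedVoltage v a b + (bound + bound) * undecided v)
    stoppedVoltage-brackets a b m = cases⇒brackets m (λ v → stoppedVoltage v a b) (<⇒≤ 0<bound)
      (λ X walk h → bounded-weaken 1≤bound (signature-bounded walk (proj₁ h) a b))
      entry
      where
      Decided : Trajectory → Matrix d → Set ℓ₁
      Decided X M = (∀ h → M ≈ᴹ signatureAtHit i j X h) × (¬ A X → M ≈ᴹ 0ᴹ)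

      -- The invariant is the norm of the whole column, because transport preserves it but not
      -- single entries.
      Open : Matrix d → Set ℓ₂
      Open M = columnNormSq b M ≤ totalNormSq

      at-start : ∀ X → Boundary (X 0) → Decided X (𝒱 (X 0))
      at-start X (inj₁ X₀≡i) =
        (λ { (zero , _) → ≡.subst (λ x → 𝒱 x ≈ᴹ Iᴹ) (≡.sym X₀≡i) source
           ; (suc t , (_ , before) , _) → contradiction X₀≡i (before 0 (s≤s z≤n)) }) ,
        (λ ¬h → contradiction (start-i X₀≡i) ¬h)
      at-start X (inj₂ X₀≡j) =
        (λ h → contradiction h (start-j X₀≡j)) ,
        (λ _ → ≡.subst (λ x → 𝒱 x ≈ᴹ 0ᴹ) (≡.sym X₀≡j) sink)

      at-step : ∀ X {M} → X 0 ~ X 1 → ¬ Boundary (X 0) → Decided (X ∘ suc) M → Decided X (transport (X 0) (X 1) M)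
      at-step X _ ¬bd (on , off) =
        (λ { (zero , (X₀≡i , _) , _) → contradiction (inj₁ X₀≡i) ¬bd
           ; (suc t , h) → ≈ᴹ-trans (*ᴹ-congˡ (σ (X 0) (X 1)) (on (t , unshift t h))) (≈ᴹ-sym (signature-suc X t)) }) ,
        (λ ¬h → ≈ᴹ-trans (*ᴹ-congˡ (σ (X 0) (X 1)) (off (¬h ∘ shift ¬bd))) (*ᴹ-zeroʳ (σ (X 0) (X 1))))

      open-step : ∀ {x y M} → x ~ y → Open M → Open (transport x y M)
      open-step {M = M} x~y M≤S = ≤-trans (≤-reflexive (columnNormSq-orthogonal (σ-orth x~y) b M)) M≤S

      entry : ∀ X → IsWalk X →
        (undecided (prefix m X) ≈ 0# × (∀ h → stoppedVoltage (prefix m X) a b ≈ signatureAtHit i j X h a b)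
                                      × (¬ A X → stoppedVoltage (prefix m X) a b ≈ 0#))
        ⊎ (undecided (prefix m X) ≈ 1# × Bounded bound (stoppedVoltage (prefix m X) a b))
      entry X walk with stopped-cases 𝒱 transport Decided Open at-start at-step (λ y → columnNormSq≤total y b) (λ {_} {_} {M} → open-step {M = M}) m X walk
      ... | inj₁ (r≈0 , on , off) = inj₁ (r≈0 , (λ h → on h a b) , (λ ¬h → off ¬h a b))
      ... | inj₂ (r≈1 , norm≤S) = inj₂ (r≈1 , bounded-square (<⇒≤ 0<bound) (begin
        stoppedVoltage (prefix m X) a b * stoppedVoltage (prefix m X) a b
          ≤⟨ square≤columnNormSq (stoppedVoltage (prefix m X)) a b ⟩
        columnNormSq b (stoppedVoltage (prefix m X))
          ≤⟨ norm≤S ⟩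
        totalNormSq
          ≈⟨ +-identityˡ _ ⟨
        0# + totalNormSq
          ≤⟨ +-monoˡ-≤ _ 0≤1 ⟩
        bound
          ≤⟨ bound≤bound² ⟩
        bound * bound
          ∎))

    voltage-expectation : ∀ x → IsMatrixExpectation x A (signatureAtHit i j) (𝒱 x)
    voltage-expectation x a b =
      brackets⇒expectation (+-pos 0<bound 0<bound) (λ v → stoppedVoltage v a b) (stoppedVoltage-brackets a b)
        -- By optional stopping the sequence is constantly `𝒱 x a b`, so it is within any tolerance
        -- from time 0 on.
        (λ ε 0<ε → 0 , λ m _ →
          let E≈𝒱 = expectation-stoppedVoltage m x a b
          in <-respˡ-≈ (sym (trans (+-congʳ E≈𝒱) (-‿inverseʳ _))) 0<ε ,
             <-respˡ-≈ (sym (trans (+-congˡ (-‿cong E≈𝒱)) (-‿inverseʳ _))) 0<ε)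

    -- Equality is stable, so it may be assumed to fail. Then `0# < p′` is refuted by the positive
    -- case, which leaves `p′ ≤ 0#`.
    voltage-factorisation : ∀ x p Ω → IsProbability x A p → IsMeanPathSignature x i j Ω → 𝒱 x ≈ᴹ p ·ᴹ Ω
    voltage-factorisation x p Ω P (p′ , M , P′ , E , C) a b =
      ≈-stable (λ 𝒱≉pΩ → 𝒱≉pΩ (nonpositive (λ 0<p′ → 𝒱≉pΩ (positive 0<p′))))
      where
      𝒱≈M : 𝒱 x a b ≈ M a b
      𝒱≈M = expectation-unique (voltage-expectation x a b) (E a b)

      p≈p′ : p ≈ p′
      p≈p′ = expectation-unique P P′

      positive : 0# < p′ → 𝒱 x a b ≈ p * Ω a b
      positive 0<p′ = begin-equality
        𝒱 x a b                               ≈⟨ 𝒱≈M ⟩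
        M a b                                 ≈⟨ *-identityˡ _ ⟨
        1# * M a b                            ≈⟨ *-congʳ (inverse-*ʳ 0<p′) ⟨
        p′ * inverse p′ 0<p′ * M a b          ≈⟨ *-assoc _ _ _ ⟩
        p′ * (inverse p′ 0<p′ * M a b)        ≈⟨ *-cong p≈p′ (C 0<p′ a b) ⟨
        p * Ω a b                             ∎

      nonpositive : p′ ≤ 0# → 𝒱 x a b ≈ p * Ω a b
      nonpositive p′≤0 = begin-equality
        𝒱 x a b     ≈⟨ 𝒱≈M ⟩
        M a b       ≈⟨ expectation-unique (E a b)
                         (nonpositiveProbability⇒zeroExpectation P′ p′≤0 (λ X walk h → signature-bounded walk (proj₁ h) a b)) ⟩
        0#          ≈⟨ zeroˡ (Ω a b) ⟨
        -- With `Z` the constant 1, the same lemma shows that `p` itself is 0, whatever `Ω` is.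
        0# * Ω a b  ≈⟨ *-congʳ (expectation-unique P
                         (nonpositiveProbability⇒zeroExpectation P′ p′≤0 (λ _ _ _ → bounded-one))) ⟨
        p * Ω a b   ∎

theorem5p8 :
  ∀ {c ℓ₁ ℓ₂} (ℝ : RealNumbers c ℓ₁ ℓ₂) {n d : ℕ} (G : ConnectionGraph ℝ n d)
    (i j : Fin n) (i≢j : i ≢ j) →
  let open RealNumbers ℝ
      open Matrices ℝ
      open Voltage G
      open RandomWalk G (deg-pos i≢j)
  in
    (𝒱 : Fin n → Matrix d) → IsConnectionVoltage i j 𝒱 →
    (x : Fin n) →
      ∃ (λ p → IsProbability x T⁰[ i ]<T⁰[ j ] p)
      × ∃ (λ M → IsMatrixExpectation x T⁰[ i ]<T⁰[ j ] (signatureAtHit i j) M)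
      × (∀ p Ω → IsProbability x T⁰[ i ]<T⁰[ j ] p → IsMeanPathSignature x i j Ω →
           𝒱 x ≈ᴹ p ·ᴹ Ω)
theorem5p8 ℝ G i j i≢j 𝒱 voltage x =
  -- The voltage itself witnesses that the signature has an expectation on the event.
  hittingProbability x , (𝒱 x , voltage-expectation 𝒱 voltage x) , voltage-factorisation 𝒱 voltage x
  where open HittingExpectations G (Voltage.deg-pos G i≢j) i j i≢j
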